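{- Let $m$ be a positive integer, let $\lambda$ be the real root of $x^3-mx^2-1$, and let $K=\mathbb{Q}(\lambda)$. Then $\left(\frac{1}{1+\lambda+\lambda^2},\frac{\lambda}{1+\lambda+\lambda^2}\right)$ is a periodic point of $T_{K,5/2}$, i.e. it lies in $\Delta_K$ and there exist positive integers $m_1\neq n_1$ with $T_{K,5/2}^{m_1}\left(\frac{1}{1+\lambda+\lambda^2},\frac{\lambda}{1+\lambda+\lambda^2}\right)=T_{K,5/2}^{n_1}\left(\frac{1}{1+\lambda+\lambda^2},\frac{\lambda}{1+\lambda+\lambda^2}\right)$.
   Context: Let $K\subset\mathbb{R}$ be a real cubic number field, $N=N_{K/\mathbb{Q}}$ its norm, and $r=5/2$. Let $\Delta_K=\{(\alpha,\beta)\in K^2:\ 1,\alpha,\beta \text{ linearly independent over }\mathbb{Q},\ \alpha,\beta>0,\ \alpha+\beta<1\}$ and $Ind=\{(i,j): i,j\in\{0,1,2\},\ i\neq j\}$. Let $\Delta=\{(x,y)\in\mathbb{R}^2: x,y\ge 0,\ x+y\le 1\}$ and $\triangle(1,2)=\{(x,y)\in\Delta: x\ge y\}$, $\triangle(2,1)=\{x\le y\}$, $\triangle(0,1)=\{2x+y-1\le 0\}$, $\triangle(1,0)=\{2x+y-1\ge 0\}$, $\triangle(0,2)=\{x+2y-1\le0\}$, $\triangle(2,0)=\{x+2y-1\ge 0\}$ (all subsets of $\Delta$). Maps $T_{(i,j)}:\triangle(i,j)\to\Delta$: $T_{(1,2)}(x,y)=(\frac{x-y}{1-y},\frac{y}{1-y})$,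 $T_{(2,1)}(x,y)=(\frac{x}{1-x},\frac{y-x}{1-x})$, $T_{(0,1)}(x,y)=(\frac{x}{1-x},\frac{y}{1-x})$, $T_{(1,0)}(x,y)=(\frac{2x+y-1}{x+y},\frac{y}{x+y})$, $T_{(0,2)}(x,y)=(\frac{x}{1-y},\frac{y}{1-y})$, $T_{(2,0)}(x,y)=(\frac{x}{x+y},\frac{x+2y-1}{x+y})$. For $(\alpha,\beta)\in\Delta_K$ put $\gamma=1-\alpha-\beta$ and $v_{\{1,2\}}=\frac{\alpha^r\beta^r}{|N(\alpha)N(\beta)|}$, $v_{\{0,1\}}=\frac{\alpha^r\gamma^r}{|N(\alpha)N(\gamma)|}$, $v_{\{0,2\}}=\frac{\beta^r\gamma^r}{|N(\beta)N(\gamma)|}$; the maximum is attained at a unique pair $\{i_0,j_0\}$. $\varepsilon(\alpha,\beta)$ is the ordered pair $(i,j)\in Ind$ with $\{i,j\}=\{i_0,j_0\}$ and $(\alpha,\beta)\in\triangle(i,j)$, and $T_{K,5/2}(\alpha,\beta)=T_{\varepsilon(\alpha,\beta)}(\alpha,\beta)$ (a map $\Delta_K\to\Delta_K$). -}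

module Defs where

open import Level using (0ℓ)
open import Algebra.Apartness.Bundles using (HeytingField; HeytingCommutativeRing)
import Algebra.Apartness.Properties.HeytingCommutativeRing as HeytingProperties
open import Algebra.Bundles using (CommutativeRing; Semiring)
import Algebra.Definitions.RawSemiring as RawSemiringDefinitions
import Algebra.Properties.Ring as RingProperties
open import Data.Empty using (⊥-elim)
open import Data.Fin.Base using (Fin)
open import Data.Fin.Patterns using (0F; 1F; 2F)
open import Data.Integer.Base using (ℤ; +_; -[1+_])
open import Data.Nat.Base using (ℕ; zero; suc)
open import Data.Product.Base using (_×_; _,_; proj₁; proj₂; ∃; ∃-syntax; Σ-syntax)
open import Data.Rational.Base as ℚ using (ℚ; mkℚ; 0ℚ)
open import Data.Rational.Properties as ℚ using ()
open import Data.Sum.Base using (_⊎_; inj₁; inj₂)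
open import Data.Vec.Functional using (Vector; []; _∷_)
open import Relation.Binary.Core using (Rel)
open import Relation.Binary.PropositionalEquality.Core using (_≡_; _≢_)
import Relation.Binary.Reasoning.Setoid as SetoidReasoning
open import Relation.Binary.Structures using (IsStrictPartialOrder)
open import Relation.Nullary.Decidable.Core using (yes; no)
open import Relation.Nullary.Negation.Core using (¬_)

-- The real numbers, axiomatised as a Dedekind-complete Archimedean ordered
-- field.  Completeness is the constructive least-upper-bound principle: a
-- supremum exists for inhabited bounded sets that are order-located.  Every set
-- is order-located under excluded middle, so classically these axioms
-- characterise ℝ up to isomorphism.
record RealNumbers : Set₁ where
  field
    heytingField : HeytingField 0ℓ 0ℓ 0ℓ

  open HeytingField heytingField public

  infix 4 _<_ _≤_
  field
    _<_                    : Rel Carrier 0ℓ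
    <-isStrictPartialOrder : IsStrictPartialOrder _≈_ _<_
    <⇒#                    : ∀ {x y} → x < y → x # y
    #⇒<⊎>                  : ∀ {x y} → x # y → x < y ⊎ y < x
    +-monoʳ-<              : ∀ z {x y} → x < y → z + x < z + y
    *-pos                  : ∀ {x y} → 0# < x → 0# < y → 0# < x * y

  _≤_ : Rel Carrier 0ℓ
  x ≤ y = ¬ (y < x)

  commutativeRing : CommutativeRing 0ℓ 0ℓ
  commutativeRing = HeytingCommutativeRing.commutativeRing heytingCommutativeRing

  open RawSemiringDefinitions
    (Semiring.rawSemiring (CommutativeRing.semiring commutativeRing)) public
    using (_^_; sum)
    renaming (_×_ to _·_)

  fromℕ : ℕ → Carrier
  fromℕ n = n · 1#

  UpperBound : (Carrier → Set) → Carrier → Set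
  UpperBound S b = ∀ {y} → S y → y ≤ b

  OrderLocated : (Carrier → Set) → Set
  OrderLocated S = ∀ {a b} → a < b → (∃[ y ] S y × a < y) ⊎ UpperBound S b

  IsSupremum : (Carrier → Set) → Carrier → Set
  IsSupremum S s = UpperBound S s × (∀ {t} → t < s → ∃[ y ] S y × t < y)

  field
    archimedean : ∀ x → ∃[ n ] x < fromℕ n
    supremum    : (S : Carrier → Set) → ∃ S → ∃ (UpperBound S) → OrderLocated S →
                  ∃ (IsSupremum S)

module RealFacts (R : RealNumbers) where
  open RealNumbers R renaming (Carrier to ℝ)
  open CommutativeRing commutativeRing using (ring)
  open IsStrictPartialOrder <-isStrictPartialOrder public
    using (<-respˡ-≈; <-respʳ-≈)
    renaming (irrefl to <-irrefl; trans to <-trans)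
  open HeytingProperties heytingCommutativeRing using (1#0; x-0≈x)
  open RingProperties ring using (-‿distribˡ-*; -‿distribʳ-*; -‿involutive; -0#≈0#)
  open SetoidReasoning setoid

  <-cotrans : ∀ {x y} → x < y → ∀ z → x < z ⊎ z < y
  <-cotrans x<y z with #-cotrans (<⇒# x<y) z
  ... | inj₁ x#z with #⇒<⊎> x#z
  ...   | inj₁ x<z = inj₁ x<z
  ...   | inj₂ z<x = inj₂ (<-trans z<x x<y)
  <-cotrans x<y z | inj₂ z#y with #⇒<⊎> z#y
  ...   | inj₁ z<y = inj₂ z<y
  ...   | inj₂ y<z = inj₁ (<-trans x<y y<z)

  ≤-trans : ∀ {x y z} → x ≤ y → y ≤ z → x ≤ z
  ≤-trans {y = y} x≤y y≤z z<x with <-cotrans z<x y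
  ... | inj₁ z<y = y≤z z<y
  ... | inj₂ y<x = x≤y y<x

  -x+[x+y]≈y : ∀ x y → - x + (x + y) ≈ y
  -x+[x+y]≈y x y = begin
    - x + (x + y)  ≈⟨ +-assoc (- x) x y ⟨
    - x + x + y    ≈⟨ +-congʳ (-‿inverseˡ x) ⟩
    0# + y         ≈⟨ +-identityˡ y ⟩
    y              ∎

  +-cancelˡ-< : ∀ z {x y} → z + x < z + y → x < y
  +-cancelˡ-< z {x} {y} p =
    <-respˡ-≈ (-x+[x+y]≈y z x) (<-respʳ-≈ (-x+[x+y]≈y z y) (+-monoʳ-< (- z) p))

  +-monoˡ-< : ∀ z {x y} → x < y → x + z < y + z
  +-monoˡ-< z {x} {y} p =
    <-respˡ-≈ (+-comm z x) (<-respʳ-≈ (+-comm z y) (+-monoʳ-< z p))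

  x<0⇒0<-x : ∀ {x} → x < 0# → 0# < - x
  x<0⇒0<-x {x} x<0 =
    <-respˡ-≈ (-‿inverseˡ x) (<-respʳ-≈ (+-identityʳ (- x)) (+-monoʳ-< (- x) x<0))

  x<y⇒0<y-x : ∀ {x y} → x < y → 0# < y - x
  x<y⇒0<y-x {x} x<y = <-respˡ-≈ (-‿inverseʳ x) (+-monoˡ-< (- x) x<y)

  y-x+x≈y : ∀ x y → y - x + x ≈ y
  y-x+x≈y x y = begin
    y - x + x      ≈⟨ +-assoc y (- x) x ⟩
    y + (- x + x)  ≈⟨ +-congˡ (-‿inverseˡ x) ⟩
    y + 0#         ≈⟨ +-identityʳ y ⟩
    y              ∎

  0<y-x⇒x<y : ∀ {x y} → 0# < y - x → x < y
  0<y-x⇒x<y {x} {y} p = <-respˡ-≈ (+-identityˡ x) (<-respʳ-≈ (y-x+x≈y x y) (+-monoˡ-< x p))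

  x<0⇒0<x² : ∀ {x} → x < 0# → 0# < x * x
  x<0⇒0<x² {x} x<0 = <-respʳ-≈ eq (*-pos (x<0⇒0<-x x<0) (x<0⇒0<-x x<0))
    where
    eq : - x * - x ≈ x * x
    eq = begin
      - x * - x      ≈⟨ -‿distribˡ-* x (- x) ⟨
      - (x * - x)    ≈⟨ -‿cong (sym (-‿distribʳ-* x x)) ⟩
      - (- (x * x))  ≈⟨ -‿involutive (x * x) ⟩
      x * x          ∎

  0<1 : 0# < 1#
  0<1 with #⇒<⊎> 1#0
  ... | inj₁ 1<0 = <-respʳ-≈ (*-identityˡ 1#) (x<0⇒0<x² 1<0)
  ... | inj₂ p   = p

  0≤x² : ∀ x → 0# ≤ x * x
  0≤x² x x²<0 = <-irrefl x²≈0 x²<0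
    where
    x≈0 : x ≈ 0#
    x≈0 = proj₁ (tight x 0#) λ x#0 → case (#⇒<⊎> x#0)
      where
      case : ¬ (x < 0# ⊎ 0# < x)
      case (inj₁ x<0) = <-irrefl refl (<-trans x²<0 (x<0⇒0<x² x<0))
      case (inj₂ 0<x) = <-irrefl refl (<-trans x²<0 (*-pos 0<x 0<x))
    x²≈0 : x * x ≈ 0#
    x²≈0 = trans (*-congʳ x≈0) (zeroˡ x)

  0<x+y : ∀ {x y} → 0# < x → 0# ≤ y → 0# < x + y
  0<x+y {x} {y} 0<x 0≤y with <-cotrans 0<x (x + y)
  ... | inj₁ p     = p
  ... | inj₂ x+y<x = ⊥-elim (0≤y (+-cancelˡ-< x (<-respʳ-≈ (sym (+-identityʳ x)) x+y<x)))

  *-monoʳ-< : ∀ {z x y} → 0# < z → x < y → z * x < z * y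
  *-monoʳ-< {z} {x} {y} 0<z x<y = 0<y-x⇒x<y (<-respʳ-≈ eq (*-pos 0<z (x<y⇒0<y-x x<y)))
    where
    eq : z * (y - x) ≈ z * y - z * x
    eq = trans (distribˡ z y (- x)) (+-congˡ (sym (-‿distribʳ-* z x)))

  x²<y² : ∀ {x y} → 0# < x → x < y → x * x < y * y
  x²<y² {x} {y} 0<x x<y = <-trans (*-monoʳ-< 0<x x<y)
    (<-respˡ-≈ (*-comm y x) (*-monoʳ-< (<-trans 0<x x<y) x<y))

  x<x+y : ∀ x {y} → 0# < y → x < x + y
  x<x+y x 0<y = <-respˡ-≈ (+-identityʳ x) (+-monoʳ-< x 0<y)

  0<fromℕ[1+n] : ∀ n → 0# < fromℕ (suc n)
  0<fromℕ[1+n] zero    = <-respʳ-≈ (sym (+-identityʳ 1#)) 0<1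
  0<fromℕ[1+n] (suc n) = <-trans 0<1 (x<x+y 1# (0<fromℕ[1+n] n))

  inverse : ∀ {d} → 0# < d → Σ[ e ∈ ℝ ] d * e ≈ 1#
  inverse {d} 0<d with #⇒invertible (#-sym (<⇒# 0<d))
  ... | e , _ , [d-0]e≈1 = e , trans (*-congʳ (sym (x-0≈x d))) [d-0]e≈1

  infixl 7 _/_∵_
  _/_∵_ : ℝ → (d : ℝ) → 0# < d → ℝ
  x / d ∵ 0<d = x * proj₁ (inverse 0<d)

  <-dense : ∀ {a b} → a < b → ∃[ c ] a < c × c < b
  <-dense {a} {b} a<b = h * (a + b) , lower , upper
    where
    2# = 1# + 1#
    0<2 : 0# < 2#
    0<2 = <-trans 0<1 (x<x+y 1# 0<1)
    h = proj₁ (inverse 0<2)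
    h#0 : h # 0#
    h#0 = invertible⇒# (2# , trans (*-congˡ (x-0≈x h)) (proj₂ (inverse 0<2))
                           , trans (*-congʳ (x-0≈x h)) (trans (*-comm h 2#) (proj₂ (inverse 0<2))))
    0<h : 0# < h
    0<h with #⇒<⊎> h#0
    ... | inj₂ 0<h = 0<h
    ... | inj₁ h<0 = ⊥-elim (<-irrefl refl (<-trans 0<1 (<-respˡ-≈ (proj₂ (inverse 0<2))
                       (<-respʳ-≈ (zeroʳ 2#) (*-monoʳ-< 0<2 h<0)))))
    double : ∀ x → h * (x + x) ≈ x
    double x = begin
      h * (x + x)            ≈⟨ *-congˡ (+-cong (*-identityˡ x) (*-identityˡ x)) ⟨
      h * (1# * x + 1# * x)  ≈⟨ *-congˡ (distribʳ x 1# 1#) ⟨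
      h * (2# * x)           ≈⟨ *-assoc h 2# x ⟨
      h * 2# * x             ≈⟨ *-congʳ (trans (*-comm h 2#) (proj₂ (inverse 0<2))) ⟩
      1# * x                 ≈⟨ *-identityˡ x ⟩
      x                      ∎
    lower : a < h * (a + b)
    lower = <-respˡ-≈ (double a) (*-monoʳ-< 0<h (+-monoʳ-< a a<b))
    upper : h * (a + b) < b
    upper = <-respʳ-≈ (double b) (*-monoʳ-< 0<h (+-monoˡ-< b a<b))

  module Sqrt (x : ℝ) where
    Below : ℝ → Set
    Below y = y ≤ 0# ⊎ y * y < x

    inhabited : ∃ Below
    inhabited = 0# , inj₁ (<-irrefl refl)

    y²<b²⇒y≤b : ∀ {b} → 0# < b → x < b * b → UpperBound Below b
    y²<b²⇒y≤b 0<b x<b² (inj₁ y≤0)  b<y = y≤0 (<-trans 0<b b<y)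
    y²<b²⇒y≤b 0<b x<b² (inj₂ y²<x) b<y =
      <-irrefl refl (<-trans (<-trans x<b² (x²<y² 0<b b<y)) y²<x)

    bounded : ∃ (UpperBound Below)
    bounded with <-cotrans 0<1 x
    ... | inj₂ x<1 = 1# , y²<b²⇒y≤b 0<1 (<-respʳ-≈ (sym (*-identityˡ 1#)) x<1)
    ... | inj₁ 0<x = 1# + x , y²<b²⇒y≤b 0<1+x (<-trans x<1+x 1+x<[1+x]²)
      where
      1<1+x : 1# < 1# + x
      1<1+x = x<x+y 1# 0<x
      0<1+x : 0# < 1# + x
      0<1+x = <-trans 0<1 1<1+x
      x<1+x : x < 1# + x
      x<1+x = <-respʳ-≈ (+-comm x 1#) (x<x+y x 0<1)
      1+x<[1+x]² : 1# + x < (1# + x) * (1# + x)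
      1+x<[1+x]² = <-respˡ-≈ (*-identityʳ (1# + x)) (*-monoʳ-< 0<1+x 1<1+x)

    located : OrderLocated Below
    located {a} {b} a<b with <-dense a<b
    ... | c , a<c , c<b with <-cotrans a<c 0#
    ...   | inj₁ a<0 = inj₁ (0# , proj₂ inhabited , a<0)
    ...   | inj₂ 0<c with <-cotrans (x²<y² 0<c c<b) x
    ...     | inj₁ c²<x = inj₁ (c , inj₂ c²<x , a<c)
    ...     | inj₂ x<b² = inj₂ (y²<b²⇒y≤b (<-trans 0<c c<b) x<b²)

  -- √ x is sup {y : y ≤ 0 or y² < x}, so √ x = 0 when x ≤ 0.
  √_ : ℝ → ℝ
  √ x = proj₁ (supremum Below inhabited bounded located)
    where open Sqrt x

  -1<0 : - 1# < 0#
  -1<0 = <-respˡ-≈ (+-identityʳ (- 1#)) (<-respʳ-≈ (-‿inverseˡ 1#) (+-monoʳ-< (- 1#) 0<1))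

  0<1+x+x² : ∀ x → 0# < 1# + x + x ^ 2
  0<1+x+x² x with <-cotrans -1<0 x
  ... | inj₁ -1<x = 0<x+y 0<1+x λ x²<0 → 0≤x² x (<-respˡ-≈ (*-congˡ (*-identityʳ x)) x²<0)
    where
    0<1+x : 0# < 1# + x
    0<1+x = <-respˡ-≈ (-‿inverseʳ 1#) (+-monoʳ-< 1# -1<x)
  ... | inj₂ x<0 = <-respʳ-≈ eq (0<x+y (x<0⇒0<-x x<0) (0≤x² (1# + x)))
    where
    eq : - x + (1# + x) * (1# + x) ≈ 1# + x + x ^ 2
    eq = begin
      - x + (1# + x) * (1# + x)                    ≈⟨ +-congˡ (distribʳ (1# + x) 1# x) ⟩
      - x + (1# * (1# + x) + x * (1# + x))         ≈⟨ +-congˡ (+-cong (*-identityˡ (1# + x)) (distribˡ x 1# x)) ⟩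
      - x + (1# + x + (x * 1# + x * x))            ≈⟨ +-congˡ (+-congˡ (+-congʳ (*-identityʳ x))) ⟩
      - x + (1# + x + (x + x * x))                 ≈⟨ +-congˡ (+-assoc (1# + x) x (x * x)) ⟨
      - x + (1# + x + x + x * x)                   ≈⟨ +-congˡ (+-congʳ (+-comm (1# + x) x)) ⟩
      - x + (x + (1# + x) + x * x)                 ≈⟨ +-congˡ (+-assoc x (1# + x) (x * x)) ⟩
      - x + (x + (1# + x + x * x))                 ≈⟨ -x+[x+y]≈y x (1# + x + x * x) ⟩
      1# + x + x * x                               ≈⟨ +-congˡ (*-congˡ (*-identityʳ x)) ⟨
      1# + x + x ^ 2                               ∎

  fromℤ : ℤ → ℝ
  fromℤ (+ n)    = fromℕ n
  fromℤ -[1+ n ] = - fromℕ (suc n)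

  fromℚ : ℚ → ℝ
  fromℚ (mkℚ p d-1 _) = fromℤ p / fromℕ (suc d-1) ∵ 0<fromℕ[1+n] d-1

det : (Fin 3 → Fin 3 → ℚ) → ℚ
det M =
  M 0F 0F ℚ.* (M 1F 1F ℚ.* M 2F 2F ℚ.- M 1F 2F ℚ.* M 2F 1F)
  ℚ.- M 0F 1F ℚ.* (M 1F 0F ℚ.* M 2F 2F ℚ.- M 1F 2F ℚ.* M 2F 0F)
  ℚ.+ M 0F 2F ℚ.* (M 1F 0F ℚ.* M 2F 1F ℚ.- M 1F 1F ℚ.* M 2F 0F)

-- Total reciprocal; only its values at nonzero arguments matter, because norms of
-- nonzero elements of a number field are nonzero.
recip : ℚ → ℚ
recip q with q ℚ.≟ 0ℚ
... | yes _  = 0ℚ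
... | no q≢0 = ℚ.1/_ q {{ℚ.≢-nonZero q≢0}}

data Ind : Set where
  ⟨1,2⟩ ⟨2,1⟩ ⟨0,1⟩ ⟨1,0⟩ ⟨0,2⟩ ⟨2,0⟩ : Ind

data UnorderedInd : Set where
  ｛1,2｝ ｛0,1｝ ｛0,2｝ : UnorderedInd

unordered : Ind → UnorderedInd
unordered ⟨1,2⟩ = ｛1,2｝
unordered ⟨2,1⟩ = ｛1,2｝
unordered ⟨0,1⟩ = ｛0,1｝
unordered ⟨1,0⟩ = ｛0,1｝
unordered ⟨0,2⟩ = ｛0,2｝
unordered ⟨2,0⟩ = ｛0,2｝

module ContinuedFraction (R : RealNumbers) where
  open RealNumbers R public renaming (Carrier to ℝ)
  open RealFacts R public

  2# : ℝ
  2# = 1# + 1#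

  -- The smallest subfield of ℝ containing a.
  data ℚ⟮_⟯ (a : ℝ) : ℝ → Set where
    generator : ℚ⟮ a ⟯ a
    one       : ℚ⟮ a ⟯ 1#
    add       : ∀ {x y} → ℚ⟮ a ⟯ x → ℚ⟮ a ⟯ y → ℚ⟮ a ⟯ (x + y)
    neg       : ∀ {x} → ℚ⟮ a ⟯ x → ℚ⟮ a ⟯ (- x)
    mul       : ∀ {x y} → ℚ⟮ a ⟯ x → ℚ⟮ a ⟯ y → ℚ⟮ a ⟯ (x * y)
    inv       : ∀ {x y} → ℚ⟮ a ⟯ x → x * y ≈ 1# → ℚ⟮ a ⟯ y
    resp      : ∀ {x y} → x ≈ y → ℚ⟮ a ⟯ x → ℚ⟮ a ⟯ y

  combination : Vector ℚ 3 → Vector ℝ 3 → ℝ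
  combination c e = sum λ i → fromℚ (c i) * e i

  LinearlyIndependent : Vector ℝ 3 → Set
  LinearlyIndependent e = (c : Vector ℚ 3) → combination c e ≈ 0# → ∀ i → c i ≡ 0ℚ

  record IsBasis (K : ℝ → Set) (e : Vector ℝ 3) : Set where
    field
      member      : ∀ i → K (e i)
      independent : LinearlyIndependent e
      spanning    : ∀ {x} → K x → ∃[ c ] x ≈ combination c e

  -- n = N_{K/ℚ}(x): the determinant of multiplication by x on the cubic field K,
  -- which does not depend on the basis in which it is computed.
  record IsNorm (K : ℝ → Set) (x : ℝ) (n : ℚ) : Set where
    field
      basis       : Vector ℝ 3
      isBasis     : IsBasis K basis
      matrix      : Fin 3 → Fin 3 → ℚ
      represents  : ∀ i → x * basis i ≈ combination (matrix i) basis
      determinant : det matrix ≡ n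

  Point : Set
  Point = ℝ × ℝ

  infix 4 _≈ₚ_
  _≈ₚ_ : Rel Point 0ℓ
  (x , y) ≈ₚ (x′ , y′) = x ≈ x′ × y ≈ y′

  record Δ[_] (K : ℝ → Set) (p : Point) : Set where
    α = proj₁ p
    β = proj₂ p
    field
      α∈K         : K α
      β∈K         : K β
      independent : LinearlyIndependent (1# ∷ α ∷ β ∷ [])
      0<α         : 0# < α
      0<β         : 0# < β
      α+β<1       : α + β < 1#

  record Δ (p : Point) : Set where
    constructor mkΔ
    x = proj₁ p
    y = proj₂ p
    field
      0≤x   : 0# ≤ x
      0≤y   : 0# ≤ y
      x+y≤1 : x + y ≤ 1#

  △ : Ind → Point → Set
  △ ⟨1,2⟩ p@(x , y) = Δ p × y ≤ x
  △ ⟨2,1⟩ p@(x , y) = Δ p × x ≤ y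
  △ ⟨0,1⟩ p@(x , y) = Δ p × 2# * x + y - 1# ≤ 0#
  △ ⟨1,0⟩ p@(x , y) = Δ p × 0# ≤ 2# * x + y - 1#
  △ ⟨0,2⟩ p@(x , y) = Δ p × x + 2# * y - 1# ≤ 0#
  △ ⟨2,0⟩ p@(x , y) = Δ p × 0# ≤ x + 2# * y - 1#

  private
    open CommutativeRing commutativeRing using (ring)
    open SetoidReasoning setoid

    ≤-respˡ : ∀ {x y z} → x ≈ y → x ≤ z → y ≤ z
    ≤-respˡ x≈y x≤z z<y = x≤z (<-respʳ-≈ (sym x≈y) z<y)

    ≤-respʳ : ∀ {x y z} → x ≈ y → z ≤ x → z ≤ y
    ≤-respʳ x≈y z≤x y<z = z≤x (<-respˡ-≈ (sym x≈y) y<z)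

    +-monoʳ-≤ : ∀ z {x y} → x ≤ y → z + x ≤ z + y
    +-monoʳ-≤ z x≤y p = x≤y (+-cancelˡ-< z p)

    +-monoˡ-≤ : ∀ z {x y} → x ≤ y → x + z ≤ y + z
    +-monoˡ-≤ z {x} {y} x≤y = ≤-respˡ (+-comm z x) (≤-respʳ (+-comm z y) (+-monoʳ-≤ z x≤y))

    x≤x+y : ∀ x {y} → 0# ≤ y → x ≤ x + y
    x≤x+y x 0≤y = ≤-respˡ (+-identityʳ x) (+-monoʳ-≤ x 0≤y)

    x-1≤0⇒x≤1 : ∀ {x} → x - 1# ≤ 0# → x ≤ 1#
    x-1≤0⇒x≤1 {x} p = ≤-respˡ (y-x+x≈y 1# x) (≤-respʳ (+-identityˡ 1#) (+-monoˡ-≤ 1# p))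

    0≤x-1⇒1≤x : ∀ {x} → 0# ≤ x - 1# → 1# ≤ x
    0≤x-1⇒1≤x {x} p = ≤-respˡ (+-identityˡ 1#) (≤-respʳ (y-x+x≈y 1# x) (+-monoˡ-≤ 1# p))

    2x≈x+x : ∀ x → 2# * x ≈ x + x
    2x≈x+x x = trans (distribʳ x 1# 1#) (+-cong (*-identityˡ x) (*-identityˡ x))

    x+x≤1⇒0<1-x : ∀ {x} → x + x ≤ 1# → 0# < 1# - x
    x+x≤1⇒0<1-x {x} x+x≤1 with <-cotrans 0<1 x
    ... | inj₂ x<1 = x<y⇒0<y-x x<1
    ... | inj₁ 0<x with <-cotrans (x<x+y x 0<x) 1#
    ...   | inj₁ x<1   = x<y⇒0<y-x x<1
    ...   | inj₂ 1<x+x = ⊥-elim (x+x≤1 1<x+x)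

    1≤x+x⇒0<x : ∀ {x} → 1# ≤ x + x → 0# < x
    1≤x+x⇒0<x {x} 1≤x+x with <-cotrans 0<1 (x + x)
    ... | inj₂ x+x<1 = ⊥-elim (1≤x+x x+x<1)
    ... | inj₁ 0<x+x with <-cotrans 0<x+x x
    ...   | inj₁ 0<x   = 0<x
    ...   | inj₂ x<x+x = +-cancelˡ-< x (<-respˡ-≈ (sym (+-identityʳ x)) x<x+x)

  denominator : Ind → Point → ℝ
  denominator ⟨1,2⟩ (x , y) = 1# - y
  denominator ⟨2,1⟩ (x , y) = 1# - x
  denominator ⟨0,1⟩ (x , y) = 1# - x
  denominator ⟨1,0⟩ (x , y) = x + y
  denominator ⟨0,2⟩ (x , y) = 1# - y
  denominator ⟨2,0⟩ (x , y) = x + y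

  numerators : Ind → Point → ℝ × ℝ
  numerators ⟨1,2⟩ (x , y) = x - y , y
  numerators ⟨2,1⟩ (x , y) = x , y - x
  numerators ⟨0,1⟩ (x , y) = x , y
  numerators ⟨1,0⟩ (x , y) = 2# * x + y - 1# , y
  numerators ⟨0,2⟩ (x , y) = x , y
  numerators ⟨2,0⟩ (x , y) = x , x + 2# * y - 1#

  0<denominator : ∀ ij {p} → △ ij p → 0# < denominator ij p
  0<denominator ⟨1,2⟩ {x , y} (mkΔ _ _ x+y≤1 , y≤x) =
    x+x≤1⇒0<1-x (≤-trans (+-monoˡ-≤ y y≤x) x+y≤1)
  0<denominator ⟨2,1⟩ {x , y} (mkΔ _ _ x+y≤1 , x≤y) =
    x+x≤1⇒0<1-x (≤-trans (+-monoʳ-≤ x x≤y) x+y≤1)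
  0<denominator ⟨0,1⟩ {x , y} (mkΔ _ 0≤y _ , q) =
    x+x≤1⇒0<1-x (≤-respˡ (2x≈x+x x) (≤-trans (x≤x+y (2# * x) 0≤y) (x-1≤0⇒x≤1 q)))
  0<denominator ⟨0,2⟩ {x , y} (mkΔ 0≤x _ _ , q) =
    x+x≤1⇒0<1-x (≤-respˡ (2x≈x+x y) (≤-trans (x≤x+y (2# * y) 0≤x)
      (≤-respˡ (+-comm x (2# * y)) (x-1≤0⇒x≤1 q))))
  0<denominator ⟨1,0⟩ {x , y} (mkΔ _ 0≤y _ , q) =
    1≤x+x⇒0<x (≤-trans (0≤x-1⇒1≤x q) (≤-respʳ eq (x≤x+y (2# * x + y) 0≤y)))
    where
    eq : 2# * x + y + y ≈ x + y + (x + y)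
    eq = begin
      2# * x + y + y        ≈⟨ +-assoc (2# * x) y y ⟩
      2# * x + (y + y)      ≈⟨ +-congˡ (2x≈x+x y) ⟨
      2# * x + 2# * y       ≈⟨ distribˡ 2# x y ⟨
      2# * (x + y)          ≈⟨ 2x≈x+x (x + y) ⟩
      x + y + (x + y)       ∎
  0<denominator ⟨2,0⟩ {x , y} (mkΔ 0≤x _ _ , q) =
    1≤x+x⇒0<x (≤-trans (0≤x-1⇒1≤x q) (≤-respʳ eq (x≤x+y (x + 2# * y) 0≤x)))
    where
    eq : x + 2# * y + x ≈ x + y + (x + y)
    eq = begin
      x + 2# * y + x        ≈⟨ +-comm (x + 2# * y) x ⟩
      x + (x + 2# * y)      ≈⟨ +-assoc x x (2# * y) ⟨
      x + x + 2# * y        ≈⟨ +-congʳ (2x≈x+x x) ⟨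
      2# * x + 2# * y       ≈⟨ distribˡ 2# x y ⟨
      2# * (x + y)          ≈⟨ 2x≈x+x (x + y) ⟩
      x + y + (x + y)       ∎

  T : ∀ ij p → △ ij p → Point
  T ij p p∈△ = proj₁ (numerators ij p) / denominator ij p ∵ 0<denominator ij p∈△
             , proj₂ (numerators ij p) / denominator ij p ∵ 0<denominator ij p∈△

  infix 9 _^5/2
  _^5/2 : ℝ → ℝ
  x ^5/2 = √ (x ^ 5)

  -- The barycentric coordinates (γ , α , β) of p = (α , β), with γ = 1 - α - β.
  coordinate : Point → Vector ℝ 3
  coordinate (α , β) = (1# - α - β) ∷ α ∷ β ∷ []

  v : Point → Vector ℚ 3 → UnorderedInd → ℝ
  v p n P = value P
    where
    v[_,_] : Fin 3 → Fin 3 → ℝ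
    v[ i , j ] = coordinate p i ^5/2 * coordinate p j ^5/2 * fromℚ (recip ℚ.∣ n i ℚ.* n j ∣)

    value : UnorderedInd → ℝ
    value ｛1,2｝ = v[ 1F , 2F ]
    value ｛0,1｝ = v[ 0F , 1F ]
    value ｛0,2｝ = v[ 0F , 2F ]

  -- ij = ε(p); norm lists the norms of the barycentric coordinates of p.
  record IsEpsilon (K : ℝ → Set) (p : Point) (ij : Ind) : Set where
    field
      norm          : Vector ℚ 3
      isNorm        : ∀ i → IsNorm K (coordinate p i) (norm i)
      uniqueMaximum : ∀ P → P ≢ unordered ij → v p norm P < v p norm (unordered ij)
      inTriangle    : △ ij p

  -- The graph of T_{K,5/2}: p ∈ Δ_K and q = T_{K,5/2}(p).
  record Step (K : ℝ → Set) (p q : Point) : Set where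
    field
      p∈Δ[K]    : Δ[ K ] p
      ε         : Ind
      isEpsilon : IsEpsilon K p ε
      image     : q ≈ₚ T ε p (IsEpsilon.inTriangle isEpsilon)

  -- The graph of the n-th iterate of T_{K,5/2}.
  Iterate : (K : ℝ → Set) → ℕ → Point → Point → Set
  Iterate K zero    p q = p ≈ₚ q
  Iterate K (suc n) p q = ∃[ r ] Step K p r × Iterate K n r q

{-# OPTIONS --safe #-}
module Submission where

-- Write a point as (γ : α : β) with γ = 1 - α - β.  A step replaces the bigger of
-- two coordinates by their difference, the two being those with the largest
-- values of |x|^{5/2} / |N(x)|, a choice independent of the scaling.  The starting
-- point is (θ² : 1 : θ), and θ is a unit of norm 1.  For 0 ≤ k < m the coordinate
-- with the smallest value in (1, θ, θ(θ - k)) is 1, because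
--   |N(θ(θ - k))| = k²(m - k) + 1 < (θ(θ - k))^{5/2}.
-- So m steps lead from (1, θ, θ²) to (1, θ, θ(θ - m)) = (1, θ, θ⁻¹), which is
-- proportional to (θ, θ², 1): the coordinates have been permuted cyclically, and
-- the point returns to itself after 3m steps.

open import Defs
open import Algebra.Bundles using (CommutativeRing)
import Algebra.Apartness.Properties.HeytingCommutativeRing as HeytingProperties
import Algebra.Properties.AbelianGroup as AbelianGroupProperties
import Algebra.Properties.CommutativeSemiring.Exp as CommutativeExp
import Algebra.Properties.Ring as RingProperties
import Algebra.Properties.Semiring.Exp as Exp
import Algebra.Properties.Semiring.Mult as Multiples
import Algebra.Properties.Semiring.Mult.TCOptimised as TCMultiples
import Algebra.Solver.Ring as RingSolver
open import Algebra.Solver.Ring.AlmostCommutativeRing using (fromCommutativeRing; _-Raw-AlmostCommutative⟶_)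
open import Data.Empty using (⊥-elim)
open import Data.Fin.Base using (Fin)
open import Data.Fin.Patterns using (0F; 1F; 2F)
open import Data.Integer.Base as ℤ using (ℤ; +_; -[1+_]; _⊖_; _◃_)
import Data.Integer.Properties as ℤ
open import Data.Maybe.Base using (just; nothing)
open import Data.Nat.Base as ℕ using (ℕ; zero; suc; z≤n; s≤s; _>_)
import Data.Nat.Coprimality as Coprimality
open import Data.Nat.Divisibility as ℕ using (_∣_; divides)
import Data.Nat.Properties as ℕ
open import Data.Nat.Solver as ℕ using ()
open import Data.Product.Base using (_×_; _,_; proj₁; proj₂; ∃-syntax)
open import Data.Rational.Base as ℚ using (ℚ; mkℚ; 0ℚ; 1ℚ; ↥_; ↧_)
import Data.Rational.Properties as ℚ
import Data.Rational.Unnormalised.Base as ℚᵘ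
open import Data.Sign.Base as Sign using ()
open import Data.Sum.Base using (_⊎_; inj₁; inj₂)
open import Data.Vec.Functional using (Vector; []; _∷_)
open import Relation.Binary.Definitions using (WeaklyDecidable)
open import Relation.Binary.PropositionalEquality.Core as ≡ using (_≡_; _≢_)
import Relation.Binary.Reasoning.Setoid as SetoidReasoning
open import Relation.Nullary.Decidable.Core using (yes; no)
open import Relation.Nullary.Negation.Core using (¬_)

-- The integer k²(m - k) + 1 is minus the value at k of the minimal polynomial of θ. With e = m - k
-- ≥ 1 it is at most m²e, hence at most (me)^{5/2}, and θ > m puts this below (θ(θ - k))^{5/2}. The
-- actual barycentric coordinates carry a further scaling factor t; its norm is never computed,
-- since it cancels from the comparison once it is known to be nonzero. Most of the work makes these
-- norms available. Equality of reals is not decidable, so whether an element vanishes is decided on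
-- its rational coefficients. K is generated with inverses, so the spanning property of 1, θ, θ²
-- requires closure of their span under inversion; explicit adjugates give it. Irreducibility of the
-- cubic enters only as the absence of rational roots: a failure of independence, or a vanishing
-- norm of an invertible element, would produce such a root. The powers x^{5/2} are square roots
-- known only as suprema, so their defining equation has to be proved as well.

-- A ring solver with integer coefficients.

module IntegerCoefficients {c ℓ} (R : CommutativeRing c ℓ) where
  open CommutativeRing R
  open RingProperties ring
  open AbelianGroupProperties +-abelianGroup using (⁻¹-∙-comm)
  open TCMultiples semiring renaming (_×_ to _·_)
  open SetoidReasoning setoid

  -- With optimised multiples `1 · 1#` reduces to `1#`, so the solver's numeral `:1` denotes `1#`
  -- itself, whereas `fromℕ 1` is `1# + 0#`.
  ⟦_⟧ℤ : ℤ → Carrier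
  ⟦ + n ⟧ℤ      = n · 1#
  ⟦ -[1+ n ] ⟧ℤ = - (suc n · 1#)

  private
    x-0≈x : ∀ x → x - 0# ≈ x
    x-0≈x x = trans (+-congˡ -0#≈0#) (+-identityʳ x)

    [1+n]×1≈1+n×1 : ∀ n → suc n · 1# ≈ 1# + n · 1#
    [1+n]×1≈1+n×1 n = ×-homo-+ 1# 1 n

    cancel-1+ : ∀ x y → (1# + x) - (1# + y) ≈ x - y
    cancel-1+ x y = begin
      (1# + x) - (1# + y)        ≈⟨ +-cong (+-comm 1# x) (sym (⁻¹-∙-comm 1# y)) ⟩
      (x + 1#) + (- 1# - y)      ≈⟨ +-assoc x 1# _ ⟩
      x + (1# + (- 1# - y))      ≈⟨ +-congˡ (+-assoc 1# (- 1#) (- y)) ⟨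
      x + ((1# - 1#) - y)        ≈⟨ +-congˡ (+-congʳ (-‿inverseʳ 1#)) ⟩
      x + (0# - y)               ≈⟨ +-congˡ (+-identityˡ (- y)) ⟩
      x - y                      ∎

  ⟦⟧-⊖ : ∀ m n → ⟦ m ⊖ n ⟧ℤ ≈ m · 1# - n · 1#
  ⟦⟧-⊖ m       zero    = sym (x-0≈x (m · 1#))
  ⟦⟧-⊖ zero    (suc n) = sym (+-identityˡ _)
  ⟦⟧-⊖ (suc m) (suc n) = begin
    ⟦ suc m ⊖ suc n ⟧ℤ                  ≡⟨ ≡.cong ⟦_⟧ℤ (ℤ.[1+m]⊖[1+n]≡m⊖n m n) ⟩
    ⟦ m ⊖ n ⟧ℤ                          ≈⟨ ⟦⟧-⊖ m n ⟩
    m · 1# - n · 1#                     ≈⟨ cancel-1+ (m · 1#) (n · 1#) ⟨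
    (1# + m · 1#) - (1# + n · 1#)       ≈⟨ +-cong ([1+n]×1≈1+n×1 m) (-‿cong ([1+n]×1≈1+n×1 n)) ⟨
    suc m · 1# - suc n · 1#             ∎

  ⟦⟧-neg : ∀ i → ⟦ ℤ.- i ⟧ℤ ≈ - ⟦ i ⟧ℤ
  ⟦⟧-neg (+ zero)  = sym -0#≈0#
  ⟦⟧-neg (+ suc n) = refl
  ⟦⟧-neg -[1+ n ]  = sym (-‿involutive _)

  ⟦⟧-+ : ∀ i j → ⟦ i ℤ.+ j ⟧ℤ ≈ ⟦ i ⟧ℤ + ⟦ j ⟧ℤ
  ⟦⟧-+ (+ m)    (+ n)    = ×-homo-+ 1# m n
  ⟦⟧-+ (+ m)    -[1+ n ] = ⟦⟧-⊖ m (suc n)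
  ⟦⟧-+ -[1+ m ] (+ n)    = trans (⟦⟧-⊖ n (suc m)) (+-comm _ _)
  ⟦⟧-+ -[1+ m ] -[1+ n ] = begin
    - (suc (suc (m ℕ.+ n)) · 1#)         ≡⟨ ≡.cong (λ k → - (suc k · 1#)) (ℕ.+-suc m n) ⟨
    - ((suc m ℕ.+ suc n) · 1#)           ≈⟨ -‿cong (×-homo-+ 1# (suc m) (suc n)) ⟩
    - (suc m · 1# + suc n · 1#)          ≈⟨ ⁻¹-∙-comm _ _ ⟨
    - (suc m · 1#) - (suc n · 1#)        ∎

  private
    ⟦⟧-◃ : ∀ n → ⟦ Sign.- ◃ n ⟧ℤ ≈ - (n · 1#)
    ⟦⟧-◃ zero    = sym -0#≈0#
    ⟦⟧-◃ (suc n) = refl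

  ⟦⟧-* : ∀ i j → ⟦ i ℤ.* j ⟧ℤ ≈ ⟦ i ⟧ℤ * ⟦ j ⟧ℤ
  ⟦⟧-* (+ m)    (+ n)    = trans (reflexive (≡.cong ⟦_⟧ℤ (ℤ.+◃n≡+n (m ℕ.* n)))) (×1-homo-* m n)
  ⟦⟧-* (+ m)    -[1+ n ] = trans (⟦⟧-◃ (m ℕ.* suc n)) (trans (-‿cong (×1-homo-* m (suc n))) (-‿distribʳ-* _ _))
  ⟦⟧-* -[1+ m ] (+ n)    = trans (⟦⟧-◃ (suc m ℕ.* n)) (trans (-‿cong (×1-homo-* (suc m) n)) (-‿distribˡ-* _ _))
  ⟦⟧-* -[1+ m ] -[1+ n ] = begin
    (suc m ℕ.* suc n) · 1#               ≈⟨ ×1-homo-* (suc m) (suc n) ⟩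
    (suc m · 1#) * (suc n · 1#)          ≈⟨ -‿involutive _ ⟨
    - - ((suc m · 1#) * (suc n · 1#))    ≈⟨ -‿cong (-‿distribʳ-* _ _) ⟩
    - ((suc m · 1#) * - (suc n · 1#))    ≈⟨ -‿distribˡ-* _ _ ⟩
    - (suc m · 1#) * - (suc n · 1#)      ∎

  private
    morphism : CommutativeRing.rawRing ℤ.+-*-commutativeRing -Raw-AlmostCommutative⟶ fromCommutativeRing R
    morphism = record
      { ⟦_⟧    = ⟦_⟧ℤ
      ; +-homo = ⟦⟧-+
      ; *-homo = ⟦⟧-*
      ; -‿homo = ⟦⟧-neg
      ; 0-homo = refl
      ; 1-homo = refl
      }

    coefficient≟ : WeaklyDecidable (λ i j → ⟦ i ⟧ℤ ≈ ⟦ j ⟧ℤ)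
    coefficient≟ i j with i ℤ.≟ j
    ... | yes i≡j = just (reflexive (≡.cong ⟦_⟧ℤ i≡j))
    ... | no  _   = nothing

  open RingSolver _ (fromCommutativeRing R) morphism coefficient≟ public
    using (Polynomial; con; _:+_; _:*_; _:-_; :-_; _:^_; solve; _:=_)

  :0 :1 : ∀ {n} → Polynomial n
  :0 = con (+ 0)
  :1 = con (+ 1)

-- Signs, inverses and monotonicity in the constructive ordered field.

module RealLemmas (R : RealNumbers) where
  open ContinuedFraction R
  open CommutativeRing commutativeRing using (semiring; ring)
  open HeytingProperties heytingCommutativeRing using (x-0≈x)
  open RingProperties ring using (-0#≈0#)
  open IntegerCoefficients commutativeRing
  open SetoidReasoning setoid

  <⇒≤ : ∀ {x y} → x < y → x ≤ y
  <⇒≤ x<y y<x = <-irrefl refl (<-trans x<y y<x)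

  abstract
    -- Since the order is undecidable, a sign has to come from apartness: `x * y` is invertible,
    -- hence so is `y`, hence `y # 0#`, and only `y < 0#` remains to be refuted.
    0<x∧0<xy⇒0<y : ∀ {x y} → 0# < x → 0# < x * y → 0# < y
    0<x∧0<xy⇒0<y {x} {y} 0<x 0<xy with inverse 0<xy
    ... | z , xyz≈1 with #⇒<⊎> y#0
      where
      yxz≈1 : y * (x * z) ≈ 1#
      yxz≈1 = trans (solve 3 (λ x y z → y :* (x :* z) := x :* y :* z) refl x y z) xyz≈1
      y#0 : y # 0#
      y#0 = invertible⇒# (x * z
        , trans (*-comm _ _) (trans (*-congʳ (x-0≈x y)) yxz≈1)
        , trans (*-congʳ (x-0≈x y)) yxz≈1)
    ...   | inj₂ 0<y = 0<y
    ...   | inj₁ y<0 = ⊥-elim (<-irrefl refl (<-trans 0<xy (<-respʳ-≈ (zeroʳ x) (*-monoʳ-< 0<x y<0))))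

    0<inverse : ∀ {x} (0<x : 0# < x) → 0# < proj₁ (inverse 0<x)
    0<inverse 0<x = 0<x∧0<xy⇒0<y 0<x (<-respʳ-≈ (sym (proj₂ (inverse 0<x))) 0<1)

    *-cancelˡ-pos : ∀ {d x y} → 0# < d → d * x ≈ d * y → x ≈ y
    *-cancelˡ-pos {d} {x} {y} 0<d dx≈dy with inverse 0<d
    ... | e , de≈1 = begin
      x            ≈⟨ *-identityˡ x ⟨
      1# * x       ≈⟨ *-congʳ de≈1 ⟨
      d * e * x    ≈⟨ solve 3 (λ d e x → d :* e :* x := e :* (d :* x)) refl d e x ⟩
      e * (d * x)  ≈⟨ *-congˡ dx≈dy ⟩
      e * (d * y)  ≈⟨ solve 3 (λ d e x → d :* e :* x := e :* (d :* x)) refl d e y ⟨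
      d * e * y    ≈⟨ *-congʳ de≈1 ⟩
      1# * y       ≈⟨ *-identityˡ y ⟩
      y            ∎

    x²<y²⇒x<y : ∀ {x y} → 0# < x → 0# < y → x * x < y * y → x < y
    x²<y²⇒x<y {x} {y} 0<x 0<y x²<y² = 0<y-x⇒x<y (0<x∧0<xy⇒0<y (<-trans 0<x (x<x+y x 0<y))
      (<-respʳ-≈ (solve 2 (λ x y → y :* y :- x :* x := (x :+ y) :* (y :- x)) refl x y) (x<y⇒0<y-x x²<y²)))

  0<x+y′ : ∀ {x y} → 0# < x → 0# < y → 0# < x + y
  0<x+y′ {x} 0<x 0<y = <-trans 0<x (x<x+y x 0<y)

  0<x^n : ∀ {x} n → 0# < x → 0# < x ^ n
  0<x^n zero    0<x = 0<1
  0<x^n (suc n) 0<x = *-pos 0<x (0<x^n n 0<x)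

  *-mono-< : ∀ {w x y z} → 0# < x → 0# < y → w < x → y < z → w * y < x * z
  *-mono-< {w} {x} {y} 0<x 0<y w<x y<z =
    <-trans (<-respˡ-≈ (*-comm y w) (<-respʳ-≈ (*-comm y x) (*-monoʳ-< 0<y w<x))) (*-monoʳ-< 0<x y<z)

  ^-monoˡ-< : ∀ {x y} n → 0# < x → x < y → x ^ suc n < y ^ suc n
  ^-monoˡ-< {x} {y} zero    0<x x<y = <-respˡ-≈ (sym (*-identityʳ x)) (<-respʳ-≈ (sym (*-identityʳ y)) x<y)
  ^-monoˡ-< {x} {y} (suc n) 0<x x<y = *-mono-< (<-trans 0<x x<y) (0<x^n (suc n) 0<x) x<y (^-monoˡ-< n 0<x x<y)

  -- Square roots as suprema.

  module _ {x s : ℝ} (0<x : 0# < x) (s-sup : IsSupremum (Sqrt.Below x) s) where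
    private
      x*1*1≈x : x * (1# * 1#) ≈ x
      x*1*1≈x = solve 1 (λ x → x :* (:1 :* :1) := x) refl x

      y²<x⇒y≤s : ∀ {y} → y * y < x → y ≤ s
      y²<x⇒y≤s y²<x = proj₁ s-sup (inj₂ y²<x)

      -- With y = x / (1 + x): x - y² = x (1 + x + x²) / (1 + x)².
      [xe]²<x : ∀ {e} → 0# < e → (1# + x) * e ≈ 1# → (x * e) * (x * e) < x
      [xe]²<x {e} 0<e [1+x]e≈1 = 0<y-x⇒x<y (<-respʳ-≈ eq (*-pos (*-pos 0<x (0<1+x+x² x)) (*-pos 0<e 0<e)))
        where
        eq : x * (1# + x + x ^ 2) * (e * e) ≈ x - (x * e) * (x * e)
        eq = begin
          x * (1# + x + x ^ 2) * (e * e)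
            ≈⟨ solve 2 (λ x e → x :* (:1 :+ x :+ x :* (x :* :1)) :* (e :* e) :=
                 x :* (((:1 :+ x) :* e) :* ((:1 :+ x) :* e)) :- (x :* e) :* (x :* e)) refl x e ⟩
          x * (((1# + x) * e) * ((1# + x) * e)) - (x * e) * (x * e)
            ≈⟨ +-congʳ (trans (*-congˡ (*-cong [1+x]e≈1 [1+x]e≈1)) x*1*1≈x) ⟩
          x - (x * e) * (x * e) ∎

    -- The number x / (1 + x) is positive and its square is below x, whether x is smaller or larger
    -- than 1. Hence the supremum cannot lie below it.
    0<sup : 0# < s
    0<sup = positive (<-cotrans (*-pos 0<x 0<e) s)
      where
      0<1+x = 0<x+y′ 0<1 0<x
      e = proj₁ (inverse 0<1+x)
      0<e = 0<inverse 0<1+x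
      positive : 0# < s ⊎ s < x * e → 0# < s
      positive (inj₁ 0<s)  = 0<s
      positive (inj₂ s<xe) = ⊥-elim (y²<x⇒y≤s ([xe]²<x 0<e (proj₂ (inverse 0<1+x))) s<xe)

    -- Heron's mean (s + x/s)/2 and the harmonic mean of s and x/s lie strictly
    -- between s and √x, so s² ≠ x contradicts the supremum property.
    private
      module Heron {e : ℝ} (0<e : 0# < e) (2se≈1 : (s + s) * e ≈ 1#) (x<s² : x < s * s) where
        t : ℝ
        t = (s * s + x) * e

        t<s : t < s
        t<s = 0<y-x⇒x<y (<-respʳ-≈ eq (*-pos 0<e (x<y⇒0<y-x x<s²)))
          where
          eq : e * (s * s - x) ≈ s - (s * s + x) * e
          eq = begin
            e * (s * s - x)
              ≈⟨ solve 3 (λ s x e → e :* (s :* s :- x) := ((s :+ s) :* e) :* s :- (s :* s :+ x) :* e) refl s x e ⟩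
            ((s + s) * e) * s - (s * s + x) * e
              ≈⟨ +-congʳ (trans (*-congʳ 2se≈1) (*-identityˡ s)) ⟩
            s - (s * s + x) * e ∎

        0<t : 0# < t
        0<t = *-pos (0<x+y′ (*-pos 0<sup 0<sup) 0<x) 0<e

        x<t² : x < t * t
        x<t² = 0<y-x⇒x<y (<-respʳ-≈ eq (*-pos (*-pos 0<e 0<e) (*-pos (x<y⇒0<y-x x<s²) (x<y⇒0<y-x x<s²))))
          where
          eq : (e * e) * ((s * s - x) * (s * s - x)) ≈ t * t - x
          eq = begin
            (e * e) * ((s * s - x) * (s * s - x))
              ≈⟨ solve 3 (λ s x e → (e :* e) :* ((s :* s :- x) :* (s :* s :- x)) :=
                   ((s :* s :+ x) :* e) :* ((s :* s :+ x) :* e) :- x :* (((s :+ s) :* e) :* ((s :+ s) :* e))) refl s x e ⟩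
            t * t - x * (((s + s) * e) * ((s + s) * e))
              ≈⟨ +-congˡ (-‿cong (trans (*-congˡ (*-cong 2se≈1 2se≈1)) x*1*1≈x)) ⟩
            t * t - x ∎

        absurd : ∀ {y} → Sqrt.Below x y → ¬ (t < y)
        absurd (inj₁ y≤0)  t<y = y≤0 (<-trans 0<t t<y)
        absurd (inj₂ y²<x) t<y = <-irrefl refl (<-trans x<t² (<-trans (x²<y² 0<t t<y) y²<x))

      x≮s² : ¬ (x < s * s)
      x≮s² x<s² = contra (proj₂ s-sup t<s)
        where
        0<2s = 0<x+y′ 0<sup 0<sup
        open Heron (0<inverse 0<2s) (proj₂ (inverse 0<2s)) x<s²
        contra : ¬ (∃[ y ] Sqrt.Below x y × t < y)
        contra (y , Below-y , t<y) = absurd Below-y t<y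

      module Harmonic {e : ℝ} (0<e : 0# < e) (de≈1 : (s * s + x) * e ≈ 1#) (s²<x : s * s < x) where
        t : ℝ
        t = (s + s) * x * e

        s<t : s < t
        s<t = 0<y-x⇒x<y (<-respʳ-≈ eq (*-pos (*-pos 0<sup 0<e) (x<y⇒0<y-x s²<x)))
          where
          eq : (s * e) * (x - s * s) ≈ t - s
          eq = begin
            (s * e) * (x - s * s)
              ≈⟨ solve 3 (λ s x e → (s :* e) :* (x :- s :* s) :=
                   (s :+ s) :* x :* e :- s :* ((s :* s :+ x) :* e)) refl s x e ⟩
            t - s * ((s * s + x) * e)
              ≈⟨ +-congˡ (-‿cong (trans (*-congˡ de≈1) (*-identityʳ s))) ⟩
            t - s ∎

        t²<x : t * t < x
        t²<x = 0<y-x⇒x<y (<-respʳ-≈ eq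
          (*-pos (*-pos 0<x (*-pos 0<e 0<e)) (*-pos (x<y⇒0<y-x s²<x) (x<y⇒0<y-x s²<x))))
          where
          eq : (x * (e * e)) * ((x - s * s) * (x - s * s)) ≈ x - t * t
          eq = begin
            (x * (e * e)) * ((x - s * s) * (x - s * s))
              ≈⟨ solve 3 (λ s x e → (x :* (e :* e)) :* ((x :- s :* s) :* (x :- s :* s)) :=
                   x :* (((s :* s :+ x) :* e) :* ((s :* s :+ x) :* e))
                   :- ((s :+ s) :* x :* e) :* ((s :+ s) :* x :* e)) refl s x e ⟩
            x * (((s * s + x) * e) * ((s * s + x) * e)) - t * t
              ≈⟨ +-congʳ (trans (*-congˡ (*-cong de≈1 de≈1)) x*1*1≈x) ⟩
            x - t * t ∎

      s²≮x : ¬ (s * s < x)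
      s²≮x s²<x = y²<x⇒y≤s t²<x s<t
        where
        0<d = 0<x+y′ (*-pos 0<sup 0<sup) 0<x
        open Harmonic (0<inverse 0<d) (proj₂ (inverse 0<d)) s²<x

    -- Tightness turns the absence of apartness into equality, so it suffices to refute both strict
    -- inequalities.
    sup²≈x : s * s ≈ x
    sup²≈x = proj₁ (tight _ _) λ s²#x → contra (#⇒<⊎> s²#x)
      where
      contra : ¬ (s * s < x ⊎ x < s * s)
      contra (inj₁ s²<x) = s²≮x s²<x
      contra (inj₂ x<s²) = x≮s² x<s²

  √-isSupremum : ∀ x → IsSupremum (Sqrt.Below x) (√ x)
  √-isSupremum x = proj₂ (supremum Below inhabited bounded located)
    where open Sqrt x

  0<√x : ∀ {x} → 0# < x → 0# < √ x
  0<√x {x} 0<x = 0<sup 0<x (√-isSupremum x)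

  √x*√x≈x : ∀ {x} → 0# < x → √ x * √ x ≈ x
  √x*√x≈x {x} 0<x = sup²≈x 0<x (√-isSupremum x)

  private
    [sd]²≈xd² : ∀ {s x d} → s * s ≈ x → (s * d) * (s * d) ≈ x * (d * d)
    [sd]²≈xd² {s} {x} {d} s²≈x =
      trans (solve 2 (λ s d → (s :* d) :* (s :* d) := (s :* s) :* (d :* d)) refl s d) (*-congʳ s²≈x)

  -- Squaring removes the roots. Applied to fifth powers, this reduces comparisons of powers 5/2 to
  -- inequalities between integral powers.
  √x*d<√y : ∀ {x y d} → 0# < x → 0# < d → x * (d * d) < y → √ x * d < √ y
  √x*d<√y {x} {y} {d} 0<x 0<d xd²<y = x²<y²⇒x<y (*-pos (0<√x 0<x) 0<d) (0<√x 0<y)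
    (<-respˡ-≈ (sym ([sd]²≈xd² (√x*√x≈x 0<x))) (<-respʳ-≈ (sym (√x*√x≈x 0<y)) xd²<y))
    where
    0<y = <-trans (*-pos 0<x (*-pos 0<d 0<d)) xd²<y

  -- The embeddings of ℕ, ℤ and ℚ, and reciprocals of absolute values.

  fromℕ-+ : ∀ m n → fromℕ (m ℕ.+ n) ≈ fromℕ m + fromℕ n
  fromℕ-+ m n = Multiples.×-homo-+ semiring 1# m n

  fromℕ-* : ∀ m n → fromℕ (m ℕ.* n) ≈ fromℕ m * fromℕ n
  fromℕ-* m n = Multiples.×1-homo-* semiring m n

  fromℕ-^ : ∀ m n → fromℕ (m ℕ.^ n) ≈ fromℕ m ^ n
  fromℕ-^ m zero    = +-identityʳ 1#
  fromℕ-^ m (suc n) = trans (fromℕ-* m (m ℕ.^ n)) (*-congˡ (fromℕ-^ m n))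

  0≤fromℕ : ∀ n → 0# ≤ fromℕ n
  0≤fromℕ zero    = <-irrefl refl
  0≤fromℕ (suc n) = <⇒≤ (0<fromℕ[1+n] n)

  fromℕ-mono-≤ : ∀ {m n} → m ℕ.≤ n → fromℕ m ≤ fromℕ n
  fromℕ-mono-≤ {n = n} z≤n = 0≤fromℕ n
  fromℕ-mono-≤ (s≤s m≤n) p = fromℕ-mono-≤ m≤n (+-cancelˡ-< 1# p)

  <-≤-trans : ∀ {x y z} → x < y → y ≤ z → x < z
  <-≤-trans {z = z} x<y y≤z with <-cotrans x<y z
  ... | inj₁ x<z = x<z
  ... | inj₂ z<y = ⊥-elim (y≤z z<y)

  ≤-<-trans : ∀ {x y z} → x ≤ y → y < z → x < z
  ≤-<-trans {x} x≤y y<z with <-cotrans y<z x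
  ... | inj₁ y<x = ⊥-elim (x≤y y<x)
  ... | inj₂ x<z = x<z

  -- Lets `fromℤ` inherit the homomorphism laws of the solver's interpretation, from which it
  -- differs only in how multiples of `1#` are summed.
  fromℤ≈⟦⟧ : ∀ i → fromℤ i ≈ ⟦ i ⟧ℤ
  fromℤ≈⟦⟧ (+ n)    = TCMultiples.×ᵤ≈× semiring n 1#
  fromℤ≈⟦⟧ -[1+ n ] = -‿cong (TCMultiples.×ᵤ≈× semiring (suc n) 1#)

  fromℤ-+ : ∀ i j → fromℤ (i ℤ.+ j) ≈ fromℤ i + fromℤ j
  fromℤ-+ i j = trans (fromℤ≈⟦⟧ (i ℤ.+ j)) (trans (⟦⟧-+ i j) (sym (+-cong (fromℤ≈⟦⟧ i) (fromℤ≈⟦⟧ j))))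

  fromℤ-* : ∀ i j → fromℤ (i ℤ.* j) ≈ fromℤ i * fromℤ j
  fromℤ-* i j = trans (fromℤ≈⟦⟧ (i ℤ.* j)) (trans (⟦⟧-* i j) (sym (*-cong (fromℤ≈⟦⟧ i) (fromℤ≈⟦⟧ j))))

  fromℤ-neg : ∀ i → fromℤ (ℤ.- i) ≈ - fromℤ i
  fromℤ-neg i = trans (fromℤ≈⟦⟧ (ℤ.- i)) (trans (⟦⟧-neg i) (-‿cong (sym (fromℤ≈⟦⟧ i))))

  fromℤ≈0⇒≡0 : ∀ i → fromℤ i ≈ 0# → i ≡ + 0
  fromℤ≈0⇒≡0 (+ zero)  _ = ≡.refl
  fromℤ≈0⇒≡0 (+ suc n) p = ⊥-elim (<-irrefl (sym p) (0<fromℕ[1+n] n))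
  fromℤ≈0⇒≡0 -[1+ n ]  p = ⊥-elim (<-irrefl (sym n≈0) (0<fromℕ[1+n] n))
    where
    n≈0 : fromℕ (suc n) ≈ 0#
    n≈0 = trans (solve 1 (λ x → x := :- (:- x)) refl _) (trans (-‿cong p) -0#≈0#)

  fromℤ-injective : ∀ i j → fromℤ i ≈ fromℤ j → i ≡ j
  fromℤ-injective i j i≈j = RingProperties.x∙y⁻¹≈ε⇒x≈y ℤ.+-*-ring i j (fromℤ≈0⇒≡0 (i ℤ.- j) (begin
    fromℤ (i ℤ.- j)           ≈⟨ trans (fromℤ-+ i (ℤ.- j)) (+-cong i≈j (fromℤ-neg j)) ⟩
    fromℤ j - fromℤ j         ≈⟨ -‿inverseʳ _ ⟩
    0#                        ∎))

  fromℚ-*↧ : ∀ q → fromℚ q * fromℤ (↧ q) ≈ fromℤ (↥ q)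
  fromℚ-*↧ (mkℚ i d-1 _) = trans (*-assoc _ _ _)
    (trans (*-congˡ (trans (*-comm _ _) (proj₂ (inverse (0<fromℕ[1+n] d-1))))) (*-identityʳ _))

  private
    0<↧ : ∀ u → 0# < fromℤ (ℚᵘ.↧ u)
    0<↧ (ℚᵘ.mkℚᵘ _ d-1) = 0<fromℕ[1+n] d-1

    fromℚ-≃ : ∀ q u → ℚ.toℚᵘ q ℚᵘ.≃ u → fromℚ q * fromℤ (ℚᵘ.↧ u) ≈ fromℤ (ℚᵘ.↥ u)
    fromℚ-≃ q@(mkℚ i d-1 _) u@(ℚᵘ.mkℚᵘ _ _) (ℚᵘ.*≡* eq) = *-cancelˡ-pos (0<↧ (ℚ.toℚᵘ q)) (begin
      fromℤ (↧ q) * (fromℚ q * fromℤ (ℚᵘ.↧ u))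
        ≈⟨ solve 3 (λ x y z → x :* (y :* z) := y :* x :* z) refl (fromℤ (↧ q)) (fromℚ q) (fromℤ (ℚᵘ.↧ u)) ⟩
      fromℚ q * fromℤ (↧ q) * fromℤ (ℚᵘ.↧ u)  ≈⟨ *-congʳ (fromℚ-*↧ q) ⟩
      fromℤ (↥ q) * fromℤ (ℚᵘ.↧ u)            ≈⟨ fromℤ-* (↥ q) (ℚᵘ.↧ u) ⟨
      fromℤ (↥ q ℤ.* ℚᵘ.↧ u)                  ≡⟨ ≡.cong fromℤ eq ⟩
      fromℤ (ℚᵘ.↥ u ℤ.* ↧ q)                  ≈⟨ fromℤ-* (ℚᵘ.↥ u) (↧ q) ⟩
      fromℤ (ℚᵘ.↥ u) * fromℤ (↧ q)            ≈⟨ *-comm _ _ ⟩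
      fromℤ (↧ q) * fromℤ (ℚᵘ.↥ u)            ∎)

  -- Sums and products in ℚ are reduced to lowest terms. Testing against an unreduced representative
  -- `u` keeps gcds out of the homomorphism proofs.
  fromℚ-unique : ∀ q u {x} → ℚ.toℚᵘ q ℚᵘ.≃ u → x * fromℤ (ℚᵘ.↧ u) ≈ fromℤ (ℚᵘ.↥ u) → fromℚ q ≈ x
  fromℚ-unique q u eq eq′ = *-cancelˡ-pos (0<↧ u)
    (trans (*-comm _ _) (trans (fromℚ-≃ q u eq) (trans (sym eq′) (*-comm _ _))))

  fromℚ-+ : ∀ p q → fromℚ (p ℚ.+ q) ≈ fromℚ p + fromℚ q
  fromℚ-+ p@record{} q@record{} = fromℚ-unique (p ℚ.+ q) (ℚ.toℚᵘ p ℚᵘ.+ ℚ.toℚᵘ q) (ℚ.toℚᵘ-homo-+ p q) (begin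
    (fromℚ p + fromℚ q) * fromℤ (↧ p ℤ.* ↧ q)
      ≈⟨ *-congˡ (fromℤ-* (↧ p) (↧ q)) ⟩
    (fromℚ p + fromℚ q) * (fromℤ (↧ p) * fromℤ (↧ q))
      ≈⟨ solve 4 (λ x y d e → (x :+ y) :* (d :* e) := (x :* d) :* e :+ (y :* e) :* d) refl
           (fromℚ p) (fromℚ q) (fromℤ (↧ p)) (fromℤ (↧ q)) ⟩
    (fromℚ p * fromℤ (↧ p)) * fromℤ (↧ q) + (fromℚ q * fromℤ (↧ q)) * fromℤ (↧ p)
      ≈⟨ +-cong (*-congʳ (fromℚ-*↧ p)) (*-congʳ (fromℚ-*↧ q)) ⟩
    fromℤ (↥ p) * fromℤ (↧ q) + fromℤ (↥ q) * fromℤ (↧ p)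
      ≈⟨ +-cong (fromℤ-* (↥ p) (↧ q)) (fromℤ-* (↥ q) (↧ p)) ⟨
    fromℤ (↥ p ℤ.* ↧ q) + fromℤ (↥ q ℤ.* ↧ p)
      ≈⟨ fromℤ-+ (↥ p ℤ.* ↧ q) (↥ q ℤ.* ↧ p) ⟨
    fromℤ (↥ p ℤ.* ↧ q ℤ.+ ↥ q ℤ.* ↧ p) ∎)

  fromℚ-* : ∀ p q → fromℚ (p ℚ.* q) ≈ fromℚ p * fromℚ q
  fromℚ-* p@record{} q@record{} = fromℚ-unique (p ℚ.* q) (ℚ.toℚᵘ p ℚᵘ.* ℚ.toℚᵘ q) (ℚ.toℚᵘ-homo-* p q) (begin
    (fromℚ p * fromℚ q) * fromℤ (↧ p ℤ.* ↧ q)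
      ≈⟨ *-congˡ (fromℤ-* (↧ p) (↧ q)) ⟩
    (fromℚ p * fromℚ q) * (fromℤ (↧ p) * fromℤ (↧ q))
      ≈⟨ solve 4 (λ x y d e → (x :* y) :* (d :* e) := (x :* d) :* (y :* e)) refl
           (fromℚ p) (fromℚ q) (fromℤ (↧ p)) (fromℤ (↧ q)) ⟩
    (fromℚ p * fromℤ (↧ p)) * (fromℚ q * fromℤ (↧ q))
      ≈⟨ *-cong (fromℚ-*↧ p) (fromℚ-*↧ q) ⟩
    fromℤ (↥ p) * fromℤ (↥ q)
      ≈⟨ fromℤ-* (↥ p) (↥ q) ⟨
    fromℤ (↥ p ℤ.* ↥ q) ∎)

  fromℚ-neg : ∀ p → fromℚ (ℚ.- p) ≈ - fromℚ p
  fromℚ-neg p@record{} = fromℚ-unique (ℚ.- p) (ℚᵘ.- ℚ.toℚᵘ p) (ℚ.toℚᵘ-homo‿- p) (begin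
    - fromℚ p * fromℤ (↧ p)    ≈⟨ solve 2 (λ x y → :- x :* y := :- (x :* y)) refl (fromℚ p) (fromℤ (↧ p)) ⟩
    - (fromℚ p * fromℤ (↧ p))  ≈⟨ -‿cong (fromℚ-*↧ p) ⟩
    - fromℤ (↥ p)              ≈⟨ fromℤ-neg (↥ p) ⟨
    fromℤ (ℤ.- ↥ p)            ∎)

  fromℚ-0 : fromℚ 0ℚ ≈ 0#
  fromℚ-0 = zeroˡ _

  fromℚ-1 : fromℚ 1ℚ ≈ 1#
  fromℚ-1 = proj₂ (inverse (0<fromℕ[1+n] 0))

  fromℚ≈0⇒≡0 : ∀ q → fromℚ q ≈ 0# → q ≡ 0ℚ
  fromℚ≈0⇒≡0 q q≈0 = ℚ.↥p≡0⇒p≡0 q (fromℤ≈0⇒≡0 (↥ q)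
    (trans (sym (fromℚ-*↧ q)) (trans (*-congʳ q≈0) (zeroˡ _))))

  fromℚ-injective : ∀ {p q} → fromℚ p ≈ fromℚ q → p ≡ q
  fromℚ-injective {p} {q} p≈q = RingProperties.x∙y⁻¹≈ε⇒x≈y ℚ.+-*-ring p q (fromℚ≈0⇒≡0 (p ℚ.- q) (begin
    fromℚ (p ℚ.- q)           ≈⟨ trans (fromℚ-+ p (ℚ.- q)) (+-cong p≈q (fromℚ-neg q)) ⟩
    fromℚ q - fromℚ q         ≈⟨ -‿inverseʳ _ ⟩
    0#                        ∎))

  0<fromℚ∣q∣ : ∀ {q} → q ≢ 0ℚ → 0# < fromℚ ℚ.∣ q ∣
  0<fromℚ∣q∣ {mkℚ (+ zero) _ _}  q≢0 = ⊥-elim (q≢0 (ℚ.↥p≡0⇒p≡0 _ ≡.refl))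
  0<fromℚ∣q∣ {mkℚ (+ suc n) d _} _   = *-pos (0<fromℕ[1+n] n) (0<inverse (0<fromℕ[1+n] d))
  0<fromℚ∣q∣ {mkℚ -[1+ n ] d _}  _   = *-pos (0<fromℕ[1+n] n) (0<inverse (0<fromℕ[1+n] d))

  ∣q∣≈q : ∀ {q} → 0# < fromℚ q → fromℚ ℚ.∣ q ∣ ≈ fromℚ q
  ∣q∣≈q {mkℚ (+ _) _ _}  _   = refl
  ∣q∣≈q {q@(mkℚ -[1+ n ] d c)} 0<q = ⊥-elim (<-irrefl refl (<-trans 0<q q<0))
    where
    q≈-∣q∣ : fromℚ q ≈ - fromℚ ℚ.∣ q ∣
    q≈-∣q∣ = solve 2 (λ x e → :- x :* e := :- (x :* e)) refl (fromℕ (suc n)) _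
    q<0 : fromℚ q < 0#
    q<0 = 0<y-x⇒x<y (<-respʳ-≈ (trans (solve 1 (λ x → x := :0 :- :- x) refl _) (+-congˡ (-‿cong (sym q≈-∣q∣))))
      (0<fromℚ∣q∣ {q} λ ()))

  q*recip[q]≡1 : ∀ {q} → q ≢ 0ℚ → q ℚ.* recip q ≡ 1ℚ
  q*recip[q]≡1 {q} q≢0 with q ℚ.≟ 0ℚ
  ... | yes q≡0  = ⊥-elim (q≢0 q≡0)
  ... | no  q≢0′ = ℚ.*-inverseʳ q {{ℚ.≢-nonZero q≢0′}}

  ∣q∣≢0 : ∀ {q} → q ≢ 0ℚ → ℚ.∣ q ∣ ≢ 0ℚ
  ∣q∣≢0 {q} q≢0 ∣q∣≡0 = q≢0 (ℚ.∣p∣≡0⇒p≡0 q ∣q∣≡0)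

  1/∣_∣ : ℚ → ℝ
  1/∣ q ∣ = fromℚ (recip ℚ.∣ q ∣)

  ∣q∣*1/∣q∣≈1 : ∀ {q} → q ≢ 0ℚ → fromℚ ℚ.∣ q ∣ * 1/∣ q ∣ ≈ 1#
  ∣q∣*1/∣q∣≈1 {q} q≢0 = begin
    fromℚ ℚ.∣ q ∣ * fromℚ (recip ℚ.∣ q ∣)  ≈⟨ fromℚ-* ℚ.∣ q ∣ (recip ℚ.∣ q ∣) ⟨
    fromℚ (ℚ.∣ q ∣ ℚ.* recip ℚ.∣ q ∣)      ≡⟨ ≡.cong fromℚ (q*recip[q]≡1 (∣q∣≢0 q≢0)) ⟩
    fromℚ 1ℚ                               ≈⟨ fromℚ-1 ⟩
    1#                                     ∎

  0<1/∣q∣ : ∀ {q} → q ≢ 0ℚ → 0# < 1/∣ q ∣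
  0<1/∣q∣ q≢0 = 0<x∧0<xy⇒0<y (0<fromℚ∣q∣ q≢0) (<-respʳ-≈ (sym (∣q∣*1/∣q∣≈1 q≢0)) 0<1)

  pq≢0 : ∀ {p q} → p ≢ 0ℚ → q ≢ 0ℚ → p ℚ.* q ≢ 0ℚ
  pq≢0 {p} {q} p≢0 q≢0 pq≡0 = <-irrefl (sym ∣p∣∣q∣≈0) (*-pos (0<fromℚ∣q∣ p≢0) (0<fromℚ∣q∣ q≢0))
    where
    ∣p∣∣q∣≈0 : fromℚ ℚ.∣ p ∣ * fromℚ ℚ.∣ q ∣ ≈ 0#
    ∣p∣∣q∣≈0 = begin
      fromℚ ℚ.∣ p ∣ * fromℚ ℚ.∣ q ∣  ≈⟨ fromℚ-* ℚ.∣ p ∣ ℚ.∣ q ∣ ⟨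
      fromℚ (ℚ.∣ p ∣ ℚ.* ℚ.∣ q ∣)    ≡⟨ ≡.cong fromℚ (ℚ.∣p*q∣≡∣p∣*∣q∣ p q) ⟨
      fromℚ ℚ.∣ p ℚ.* q ∣            ≡⟨ ≡.cong (λ r → fromℚ ℚ.∣ r ∣) {y = 0ℚ} pq≡0 ⟩
      fromℚ 0ℚ                       ≈⟨ fromℚ-0 ⟩
      0#                             ∎

  -- This is what splits the value `v` of a pair into one factor for each of its two coordinates.
  1/∣pq∣ : ∀ {p q} → p ≢ 0ℚ → q ≢ 0ℚ → 1/∣ p ℚ.* q ∣ ≈ 1/∣ p ∣ * 1/∣ q ∣
  1/∣pq∣ {p} {q} p≢0 q≢0 = *-cancelˡ-pos (0<fromℚ∣q∣ (pq≢0 p≢0 q≢0)) (begin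
    fromℚ ℚ.∣ p ℚ.* q ∣ * 1/∣ p ℚ.* q ∣  ≈⟨ ∣q∣*1/∣q∣≈1 (pq≢0 p≢0 q≢0) ⟩
    1#                                   ≈⟨ *-identityˡ 1# ⟨
    1# * 1#                              ≈⟨ *-cong (∣q∣*1/∣q∣≈1 p≢0) (∣q∣*1/∣q∣≈1 q≢0) ⟨
    (fromℚ ℚ.∣ p ∣ * 1/∣ p ∣) * (fromℚ ℚ.∣ q ∣ * 1/∣ q ∣)
      ≈⟨ solve 4 (λ a b c d → (a :* b) :* (c :* d) := (a :* c) :* (b :* d)) refl (fromℚ ℚ.∣ p ∣) 1/∣ p ∣ (fromℚ ℚ.∣ q ∣) 1/∣ q ∣ ⟩
    (fromℚ ℚ.∣ p ∣ * fromℚ ℚ.∣ q ∣) * (1/∣ p ∣ * 1/∣ q ∣)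
      ≈⟨ *-congʳ (trans (sym (fromℚ-* ℚ.∣ p ∣ ℚ.∣ q ∣)) (reflexive (≡.cong fromℚ (≡.sym (ℚ.∣p*q∣≡∣p∣*∣q∣ p q))))) ⟩
    fromℚ ℚ.∣ p ℚ.* q ∣ * (1/∣ p ∣ * 1/∣ q ∣) ∎)

-- Coprimality cancels two of the three factors `p`; then `d` divides `p` as well as itself.
coprime∧∣cube⇒≡1 : ∀ {p d} → Coprimality.Coprime p d → d ∣ p ℕ.* (p ℕ.* p) → d ≡ 1
coprime∧∣cube⇒≡1 {p} {d} c d∣p³ = c (coprime-divisor′ (coprime-divisor′ d∣p³) , ℕ.∣-refl)
  where
  coprime-divisor′ : ∀ {j} → d ∣ p ℕ.* j → d ∣ j
  coprime-divisor′ = Coprimality.coprime-divisor (Coprimality.sym c)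

-- Rational elements of the real field.

module Rationals (R : RealNumbers) where
  open ContinuedFraction R
  open RealLemmas R
  open SetoidReasoning setoid

  -- Coefficients remain real numbers that carry a witness of rationality: polynomial identities are
  -- then solved in ℝ, while tests for zero go back to ℚ.
  Rational : ℝ → Set
  Rational x = ∃[ q ] fromℚ q ≈ x

  rat-+ : ∀ {x y} → Rational x → Rational y → Rational (x + y)
  rat-+ (p , p≈x) (q , q≈y) = p ℚ.+ q , trans (fromℚ-+ p q) (+-cong p≈x q≈y)

  rat-* : ∀ {x y} → Rational x → Rational y → Rational (x * y)
  rat-* (p , p≈x) (q , q≈y) = p ℚ.* q , trans (fromℚ-* p q) (*-cong p≈x q≈y)

  rat-neg : ∀ {x} → Rational x → Rational (- x)
  rat-neg (p , p≈x) = ℚ.- p , trans (fromℚ-neg p) (-‿cong p≈x)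

  rat-resp : ∀ {x y} → x ≈ y → Rational x → Rational y
  rat-resp x≈y (q , q≈x) = q , trans q≈x x≈y

  rat-0 : Rational 0#
  rat-0 = 0ℚ , fromℚ-0

  rat-1 : Rational 1#
  rat-1 = 1ℚ , fromℚ-1

  abstract
    rat-fromℕ : ∀ n → Rational (fromℕ n)
    rat-fromℕ zero    = rat-0
    rat-fromℕ (suc n) = rat-+ rat-1 (rat-fromℕ n)

  -- Decidable equality on ℚ provides the zero test that the reals do not have.
  rat-zero⊎invertible : ∀ {x} → Rational x → x ≈ 0# ⊎ (∃[ y ] Rational y × x * y ≈ 1#)
  rat-zero⊎invertible {x} (q , q≈x) with q ℚ.≟ 0ℚ
  ... | yes ≡.refl = inj₁ (trans (sym q≈x) fromℚ-0)
  ... | no  q≢0 = inj₂ (fromℚ (recip q) , (recip q , refl) , (begin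
    x * fromℚ (recip q)        ≈⟨ *-congʳ q≈x ⟨
    fromℚ q * fromℚ (recip q)  ≈⟨ fromℚ-* q (recip q) ⟨
    fromℚ (q ℚ.* recip q)      ≡⟨ ≡.cong fromℚ (q*recip[q]≡1 q≢0) ⟩
    fromℚ 1ℚ                   ≈⟨ fromℚ-1 ⟩
    1#                         ∎))

-- The cubic equation: location of its root and absence of rational roots.

module CubicField (R : RealNumbers) (m : ℕ) (m>0 : m > 0) where
  open ContinuedFraction R
  open HeytingProperties heytingCommutativeRing using (x-0≈x)
  open RealLemmas R
  open Rationals R
  open IntegerCoefficients commutativeRing
  open SetoidReasoning setoid

  M : ℝ
  M = fromℕ m

  -- The cubic in the form that exhibits `x` as a unit with inverse `x * (x - M)`.
  IsRoot : ℝ → Set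
  IsRoot x = x * x * (x - M) ≈ 1#

  -- The factor `x - M` divides 1 and is therefore apart from 0; if it were negative, `x * x` would
  -- be negative too.
  root>m : ∀ {x} → IsRoot x → M < x
  root>m {x} x²[x-m]≈1 = 0<y-x⇒x<y (positive (#⇒<⊎> x-M#0))
    where
    x-M#0 : (x - M) # 0#
    x-M#0 = invertible⇒# (x * x , trans (*-congˡ (x-0≈x _)) x²[x-m]≈1
                                , trans (*-congʳ (x-0≈x _)) (trans (*-comm _ _) x²[x-m]≈1))
    1≈[M-x][-x²] : 1# ≈ - (x - M) * (0# - x * x)
    1≈[M-x][-x²] = trans (sym x²[x-m]≈1)
      (solve 2 (λ x m → x :* x :* (x :- m) := :- (x :- m) :* (:0 :- x :* x)) refl x M)
    positive : x - M < 0# ⊎ 0# < x - M → 0# < x - M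
    positive (inj₂ 0<x-M) = 0<x-M
    positive (inj₁ x-M<0) =
      ⊥-elim (0≤x² x (0<y-x⇒x<y (0<x∧0<xy⇒0<y (x<0⇒0<-x x-M<0) (<-respʳ-≈ 1≈[M-x][-x²] 0<1))))

  1≤M : 1# ≤ M
  1≤M p = fromℕ-mono-≤ m>0 (<-respʳ-≈ (sym (+-identityʳ 1#)) p)

  -- For a root p/d in lowest terms, d divides p³, so d = 1. Then p(p² - mp) = 1 makes p equal to 1
  -- or -1, which contradicts `1# ≤ M` and `M < x`.
  no-rational-root : ∀ {x} → Rational x → ¬ IsRoot x
  no-rational-root {x} (q@(mkℚ p d-1 c) , q≈x) isRoot = x≤1 p ∣p∣≡1 x≈p (≤-<-trans 1≤M (root>m isRoot))
    where
    d = suc d-1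
    P = fromℤ p
    D = fromℕ d
    -- The equation cleared of denominators; d divides p³ and is coprime to p.
    p³≈ : P * (P * P) ≈ D * (D * D + M * (P * P))
    p³≈ = begin
      P * (P * P)
        ≈⟨ *-cong P≈xD (*-cong P≈xD P≈xD) ⟩
      (x * D) * ((x * D) * (x * D))
        ≈⟨ solve 3 (λ x d m → (x :* d) :* ((x :* d) :* (x :* d)) :=
             d :* (d :* d :* (x :* x :* (x :- m)) :+ m :* ((x :* d) :* (x :* d)))) refl x D M ⟩
      D * (D * D * (x * x * (x - M)) + M * ((x * D) * (x * D)))
        ≈⟨ *-congˡ (+-cong (trans (*-congˡ isRoot) (*-identityʳ _)) (*-congˡ (*-cong (sym P≈xD) (sym P≈xD)))) ⟩
      D * (D * D + M * (P * P)) ∎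
      where
      P≈xD : P ≈ x * D
      P≈xD = trans (sym (fromℚ-*↧ q)) (*-congʳ q≈x)

    e : ℤ
    e = + d ℤ.* + d ℤ.+ + m ℤ.* (p ℤ.* p)

    p³≡de : p ℤ.* (p ℤ.* p) ≡ + d ℤ.* e
    p³≡de = fromℤ-injective (p ℤ.* (p ℤ.* p)) (+ d ℤ.* e) (begin
      fromℤ (p ℤ.* (p ℤ.* p))
        ≈⟨ trans (fromℤ-* p (p ℤ.* p)) (*-congˡ (fromℤ-* p p)) ⟩
      P * (P * P)
        ≈⟨ p³≈ ⟩
      D * (D * D + M * (P * P))
        ≈⟨ *-congˡ (+-cong (fromℤ-* (+ d) (+ d)) (trans (fromℤ-* (+ m) (p ℤ.* p)) (*-congˡ (fromℤ-* p p)))) ⟨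
      D * (fromℤ (+ d ℤ.* + d) + fromℤ (+ m ℤ.* (p ℤ.* p)))
        ≈⟨ *-congˡ (fromℤ-+ (+ d ℤ.* + d) (+ m ℤ.* (p ℤ.* p))) ⟨
      D * fromℤ e
        ≈⟨ fromℤ-* (+ d) e ⟨
      fromℤ (+ d ℤ.* e) ∎)

    d∣p³ : d ∣ ℤ.∣ p ∣ ℕ.* (ℤ.∣ p ∣ ℕ.* ℤ.∣ p ∣)
    d∣p³ = divides ℤ.∣ e ∣ (≡.trans (≡.sym (≡.trans (ℤ.abs-* p (p ℤ.* p)) (≡.cong (ℤ.∣ p ∣ ℕ.*_) (ℤ.abs-* p p))))
      (≡.trans (≡.cong ℤ.∣_∣ p³≡de) (≡.trans (ℤ.abs-* (+ d) e) (ℕ.*-comm d ℤ.∣ e ∣))))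

    d≡1 : d ≡ 1
    d≡1 = coprime∧∣cube⇒≡1 (Coprimality.recompute c) d∣p³

    D≈1 : D ≈ 1#
    D≈1 = trans (reflexive (≡.cong fromℕ d≡1)) (+-identityʳ 1#)

    x≈p : x ≈ P
    x≈p = trans (sym q≈x) (trans (sym (trans (*-congˡ D≈1) (*-identityʳ _))) (fromℚ-*↧ q))

    ∣p∣≡1 : ℤ.∣ p ∣ ≡ 1
    ∣p∣≡1 = ℕ.m*n≡1⇒m≡1 ℤ.∣ p ∣ _ (≡.trans (≡.sym (ℤ.abs-* p f)) (≡.cong ℤ.∣_∣ pf≡1))
      where
      f = p ℤ.* p ℤ.- + m ℤ.* p
      pf≡1 : p ℤ.* f ≡ + 1
      pf≡1 = fromℤ-injective (p ℤ.* f) (+ 1) (begin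
        fromℤ (p ℤ.* f)
          ≈⟨ trans (fromℤ-* p f) (*-congˡ (fromℤ-+ (p ℤ.* p) (ℤ.- (+ m ℤ.* p)))) ⟩
        P * (fromℤ (p ℤ.* p) + fromℤ (ℤ.- (+ m ℤ.* p)))
          ≈⟨ *-congˡ (+-cong (fromℤ-* p p) (trans (fromℤ-neg (+ m ℤ.* p)) (-‿cong (fromℤ-* (+ m) p)))) ⟩
        P * (P * P - M * P)
          ≈⟨ solve 2 (λ x m → x :* (x :* x :- m :* x) := x :* x :* (x :- m)) refl P M ⟩
        P * P * (P - M)
          ≈⟨ *-cong (*-cong x≈p x≈p) (+-congʳ x≈p) ⟨
        x * x * (x - M)
          ≈⟨ isRoot ⟩
        1#
          ≈⟨ +-identityʳ 1# ⟨
        fromℤ (+ 1) ∎)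

    x≤1 : ∀ p → ℤ.∣ p ∣ ≡ 1 → x ≈ fromℤ p → x ≤ 1#
    x≤1 (+ 1)    _ x≈p = <-irrefl (sym (trans x≈p (+-identityʳ 1#)))
    x≤1 -[1+ 0 ] _ x≈p 1<x = <-irrefl refl (<-trans 1<x (<-respˡ-≈ (sym (trans x≈p (-‿cong (+-identityʳ 1#)))) (<-trans -1<0 0<1)))

-- The basis 1, θ, θ² of K, inverses, and norms.

module PowerBasis (R : RealNumbers) (m : ℕ) (m>0 : m > 0)
  (θ : RealNumbers.Carrier R) (isRoot : CubicField.IsRoot R m m>0 θ) where
  open ContinuedFraction R hiding (v)
  open CubicField R m m>0
  open RealLemmas R
  open Rationals R
  open IntegerCoefficients commutativeRing
  open SetoidReasoning setoid

  K : ℝ → Set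
  K = ℚ⟮ θ ⟯

  Φ : ℝ
  Φ = θ * θ * (θ - M) - 1#

  Φ≈0 : Φ ≈ 0#
  Φ≈0 = trans (+-congʳ isRoot) (-‿inverseʳ 1#)

  -- Identities that hold modulo the cubic are given to the solver as polynomial identities with an
  -- explicit multiple of `Φ`, which this lemma then removes.
  y+Φq≈y : ∀ y q → y + Φ * q ≈ y
  y+Φq≈y y q = trans (+-congˡ (trans (*-congʳ Φ≈0) (zeroˡ q))) (+-identityʳ y)

  rat-M : Rational M
  rat-M = rat-fromℕ m

  ⟪_,_,_⟫ : ℝ → ℝ → ℝ → ℝ
  ⟪ a , b , c ⟫ = a + b * θ + c * (θ * θ)

  ⟪⟫-cong : ∀ {a a′ b b′ c c′} → a ≈ a′ → b ≈ b′ → c ≈ c′ → ⟪ a , b , c ⟫ ≈ ⟪ a′ , b′ , c′ ⟫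
  ⟪⟫-cong p q r = +-cong (+-cong p (*-congʳ q)) (*-congʳ r)

  linear-independent : ∀ {a b} → Rational a → Rational b → a + b * θ ≈ 0# → a ≈ 0# × b ≈ 0#
  linear-independent {a} {b} ra rb a+bθ≈0 with rat-zero⊎invertible rb
  ... | inj₁ b≈0 = trans (solve 3 (λ a b t → a := a :+ b :* t :- b :* t) refl a b θ)
      (trans (+-cong a+bθ≈0 (-‿cong (trans (*-congʳ b≈0) (zeroˡ θ)))) (-‿inverseʳ 0#)) , b≈0
  ... | inj₂ (y , ry , by≈1) = ⊥-elim (no-rational-root (rat-resp (sym θ≈-ay) (rat-neg (rat-* ra ry))) isRoot)
    where
    θ≈-ay : θ ≈ - (a * y)
    θ≈-ay = begin
      θ                            ≈⟨ *-identityˡ θ ⟨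
      1# * θ                       ≈⟨ *-congʳ by≈1 ⟨
      b * y * θ                    ≈⟨ solve 4 (λ a b t y → b :* y :* t := (a :+ b :* t) :* y :- a :* y) refl a b θ y ⟩
      (a + b * θ) * y - a * y      ≈⟨ +-congʳ (trans (*-congʳ a+bθ≈0) (zeroˡ y)) ⟩
      0# - a * y                   ≈⟨ +-identityˡ _ ⟩
      - (a * y)                    ∎

  -- If θ² = u θ + v with u, v rational, then dividing x³ - m x² - 1 by
  -- x² - u x - v shows that m - u is a rational root.
  independent : ∀ {a b c} → Rational a → Rational b → Rational c →
                ⟪ a , b , c ⟫ ≈ 0# → a ≈ 0# × b ≈ 0# × c ≈ 0#
  independent {a} {b} {c} ra rb rc eq with rat-zero⊎invertible rc
  ... | inj₁ c≈0 = proj₁ ab≈0 , proj₂ ab≈0 , c≈0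
    where
    ab≈0 = linear-independent ra rb (begin
      a + b * θ                        ≈⟨ +-identityʳ _ ⟨
      a + b * θ + 0#                   ≈⟨ +-congˡ (trans (*-congʳ c≈0) (zeroˡ _)) ⟨
      ⟪ a , b , c ⟫                    ≈⟨ eq ⟩
      0#                               ∎)
  ... | inj₂ (y , ry , cy≈1) = ⊥-elim (no-rational-root (rat-+ rat-M (rat-neg ru)) root)
    where
    u = - (b * y)
    v = - (a * y)
    ru = rat-neg (rat-* rb ry)
    rv = rat-neg (rat-* ra ry)

    θ²-uθ-v≈0 : θ * θ - u * θ - v ≈ 0#
    θ²-uθ-v≈0 = begin
      θ * θ - u * θ - v
        ≈⟨ +-congʳ (+-congʳ (trans (sym (*-identityˡ _)) (*-congʳ (sym cy≈1)))) ⟩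
      c * y * (θ * θ) - u * θ - v
        ≈⟨ solve 5 (λ a b c y t → c :* y :* (t :* t) :- :- (b :* y) :* t :- :- (a :* y) :=
             (a :+ b :* t :+ c :* (t :* t)) :* y) refl a b c y θ ⟩
      ⟪ a , b , c ⟫ * y
        ≈⟨ trans (*-congʳ eq) (zeroˡ y) ⟩
      0# ∎

    remainder₀ = u * v - M * v - 1#
    remainder₁ = u * u + v - M * u

    remainder≈0 : remainder₀ + remainder₁ * θ ≈ 0#
    remainder≈0 = begin
      remainder₀ + remainder₁ * θ
        ≈⟨ solve 4 (λ t u v m → (u :* v :- m :* v :- :1) :+ (u :* u :+ v :- m :* u) :* t :=
             (t :* t :* (t :- m) :- :1) :- (t :* t :- u :* t :- v) :* (t :+ u :- m)) refl θ u v M ⟩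
      Φ - (θ * θ - u * θ - v) * (θ + u - M)
        ≈⟨ +-cong Φ≈0 (-‿cong (trans (*-congʳ θ²-uθ-v≈0) (zeroˡ _))) ⟩
      0# - 0#
        ≈⟨ -‿inverseʳ 0# ⟩
      0# ∎

    remainders≈0 = linear-independent
      (rat-+ (rat-+ (rat-* ru rv) (rat-neg (rat-* rat-M rv))) (rat-neg rat-1))
      (rat-+ (rat-+ (rat-* ru ru) rv) (rat-neg (rat-* rat-M ru))) remainder≈0

    root : IsRoot (M - u)
    root = begin
      (M - u) * (M - u) * (M - u - M)
        ≈⟨ solve 3 (λ u v m → (m :- u) :* (m :- u) :* (m :- u :- m) :=
             :1 :+ (u :* v :- m :* v :- :1) :- (u :* u :+ v :- m :* u) :* (u :- m)) refl u v M ⟩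
      1# + remainder₀ - remainder₁ * (u - M)
        ≈⟨ +-cong (+-congˡ (proj₁ remainders≈0)) (-‿cong (trans (*-congʳ (proj₂ remainders≈0)) (zeroˡ _))) ⟩
      1# + 0# - 0#
        ≈⟨ solve 0 (:1 :+ :0 :- :0 := :1) refl ⟩
      1# ∎

  rat-x²≈0⇒x≈0 : ∀ {x} → Rational x → x * x ≈ 0# → x ≈ 0#
  rat-x²≈0⇒x≈0 {x} rx x²≈0 with rat-zero⊎invertible rx
  ... | inj₁ x≈0 = x≈0
  ... | inj₂ (y , _ , xy≈1) = begin
    x              ≈⟨ *-identityʳ x ⟨
    x * 1#         ≈⟨ *-congˡ xy≈1 ⟨
    x * (x * y)    ≈⟨ *-assoc x x y ⟨
    x * x * y      ≈⟨ trans (*-congʳ x²≈0) (zeroˡ y) ⟩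
    0#             ∎

  -- Row i of multiplication is the coordinate vector of ⟪ a , b , c ⟫ * θ ^ i.
  multiplication : ℝ → ℝ → ℝ → Fin 3 → Vector ℝ 3
  multiplication a b c 0F = a ∷ b ∷ c ∷ []
  multiplication a b c 1F = c ∷ a ∷ b + M * c ∷ []
  multiplication a b c 2F = b + M * c ∷ c ∷ a + M * (b + M * c) ∷ []

  detℝ : (Fin 3 → Vector ℝ 3) → ℝ
  detℝ E =
    E 0F 0F * (E 1F 1F * E 2F 2F - E 1F 2F * E 2F 1F)
    - E 0F 1F * (E 1F 0F * E 2F 2F - E 1F 2F * E 2F 0F)
    + E 0F 2F * (E 1F 0F * E 2F 1F - E 1F 1F * E 2F 0F)

  rat-detℝ : ∀ {E} → (∀ i j → Rational (E i j)) → Rational (detℝ E)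
  rat-detℝ r = rat-+ (rat-+
    (rat-* (r 0F 0F) (minor (r 1F 1F) (r 2F 2F) (r 1F 2F) (r 2F 1F)))
    (rat-neg (rat-* (r 0F 1F) (minor (r 1F 0F) (r 2F 2F) (r 1F 2F) (r 2F 0F)))))
    (rat-* (r 0F 2F) (minor (r 1F 0F) (r 2F 1F) (r 1F 1F) (r 2F 0F)))
    where
    minor : ∀ {x y z w} → Rational x → Rational y → Rational z → Rational w → Rational (x * y - z * w)
    minor rx ry rz rw = rat-+ (rat-* rx ry) (rat-neg (rat-* rz rw))

  norm : ℝ → ℝ → ℝ → ℝ
  norm a b c = detℝ (multiplication a b c)

  -- The coordinates of the product of the two other conjugates of ⟪ a , b , c ⟫.
  adj₀ adj₁ adj₂ : ℝ → ℝ → ℝ → ℝ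
  adj₀ a b c = a * (a + M * (b + M * c)) - (b + M * c) * c
  adj₁ a b c = c * c - b * (a + M * (b + M * c))
  adj₂ a b c = b * (b + M * c) - a * c

  θ*⟪⟫ : ∀ a b c → θ * ⟪ a , b , c ⟫ ≈ ⟪ c , a , b + M * c ⟫
  θ*⟪⟫ a b c = trans
    (solve 5 (λ a b c t m → t :* (a :+ b :* t :+ c :* (t :* t)) :=
      (c :+ a :* t :+ (b :+ m :* c) :* (t :* t)) :+ (t :* t :* (t :- m) :- :1) :* c) refl a b c θ M)
    (y+Φq≈y _ c)

  -- The second factor has as coordinates the cofactors of the first column of
  -- `multiplication a b c`, so the product has coordinates (`norm a b c`, 0, 0). The term with `Φ`
  -- absorbs the powers θ³ and θ⁴.
  ⟪⟫*adjugate : ∀ a b c → ⟪ a , b , c ⟫ * ⟪ adj₀ a b c , adj₁ a b c , adj₂ a b c ⟫ ≈ norm a b c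
  ⟪⟫*adjugate a b c = trans
    (solve 5 (λ a b c t m →
      let r = b :+ m :* c
          s = a :+ m :* r
          x = a :* s :- r :* c
          y = c :* c :- b :* s
          z = b :* r :- a :* c
      in (a :+ b :* t :+ c :* (t :* t)) :* (x :+ y :* t :+ z :* (t :* t)) :=
         (a :* (a :* s :- r :* c) :- b :* (c :* s :- r :* r) :+ c :* (c :* c :- a :* r))
         :+ (t :* t :* (t :- m) :- :1) :* (c :* z :* t :+ (b :* z :+ c :* y :+ m :* (c :* z)))) refl a b c θ M)
    (y+Φq≈y _ _)

  module _ {a b c : ℝ} (ra : Rational a) (rb : Rational b) (rc : Rational c) where
    private
      rr = rat-+ rb (rat-* rat-M rc)
      rs = rat-+ ra (rat-* rat-M rr)

    rat-adj₀ : Rational (adj₀ a b c)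
    rat-adj₀ = rat-+ (rat-* ra rs) (rat-neg (rat-* rr rc))
    rat-adj₁ : Rational (adj₁ a b c)
    rat-adj₁ = rat-+ (rat-* rc rc) (rat-neg (rat-* rb rs))
    rat-adj₂ : Rational (adj₂ a b c)
    rat-adj₂ = rat-+ (rat-* rb rr) (rat-neg (rat-* ra rc))

    rat-multiplication : ∀ i j → Rational (multiplication a b c i j)
    rat-multiplication 0F 0F = ra
    rat-multiplication 0F 1F = rb
    rat-multiplication 0F 2F = rc
    rat-multiplication 1F 0F = rc
    rat-multiplication 1F 1F = ra
    rat-multiplication 1F 2F = rr
    rat-multiplication 2F 0F = rr
    rat-multiplication 2F 1F = rc
    rat-multiplication 2F 2F = rs

    -- If c = 0, the adjugate contains b² and then a². Otherwise put w = b/c: the third equation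
    -- gives a/c = w(w + m), and the second becomes 1 = w(w + m)², so m + w would be a rational
    -- root.
    adjugate≈0⇒≈0 : adj₀ a b c ≈ 0# → adj₁ a b c ≈ 0# → adj₂ a b c ≈ 0# → a ≈ 0# × b ≈ 0# × c ≈ 0#
    adjugate≈0⇒≈0 x≈0 y≈0 z≈0 with rat-zero⊎invertible rc
    ... | inj₁ c≈0 = a≈0 , b≈0 , c≈0
      where
      b≈0 : b ≈ 0#
      b≈0 = rat-x²≈0⇒x≈0 rb (begin
        b * b
          ≈⟨ solve 4 (λ a b c m → b :* b := b :* (b :+ m :* c) :- a :* c :+ c :* (a :- b :* m)) refl a b c M ⟩
        adj₂ a b c + c * (a - b * M)
          ≈⟨ +-cong z≈0 (trans (*-congʳ c≈0) (zeroˡ _)) ⟩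
        0# + 0#
          ≈⟨ +-identityʳ 0# ⟩
        0# ∎)
      a≈0 : a ≈ 0#
      a≈0 = rat-x²≈0⇒x≈0 ra (begin
        a * a
          ≈⟨ solve 4 (λ a b c m → a :* a :=
               (a :* (a :+ m :* (b :+ m :* c)) :- (b :+ m :* c) :* c)
               :+ b :* (c :- a :* m) :+ c :* (m :* c :- m :* m :* a)) refl a b c M ⟩
        adj₀ a b c + b * (c - a * M) + c * (M * c - M * M * a)
          ≈⟨ +-cong (+-cong x≈0 (trans (*-congʳ b≈0) (zeroˡ _))) (trans (*-congʳ c≈0) (zeroˡ _)) ⟩
        0# + 0# + 0#
          ≈⟨ solve 0 (:0 :+ :0 :+ :0 := :0) refl ⟩
        0# ∎)
    ... | inj₂ (y , ry , cy≈1) = ⊥-elim (no-rational-root (rat-+ rat-M (rat-* rb ry)) root)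
      where
      w = b * y
      root : IsRoot (M + w)
      root = begin
        (M + w) * (M + w) * (M + w - M)
          ≈⟨ *-cong (*-cong M+w≈ M+w≈) (solve 2 (λ m w → m :+ w :- m := w) refl M w) ⟩
        (M * (c * y) + w) * (M * (c * y) + w) * w
          ≈⟨ solve 5 (λ a b c m y →
               let r = b :+ m :* c
                   s = a :+ m :* r
               in (m :* (c :* y) :+ b :* y) :* (m :* (c :* y) :+ b :* y) :* (b :* y) :=
                  (c :* y) :* ((c :* y) :* (c :* y) :- (c :* c :- b :* s) :* (y :* y))
                  :+ (b :* r :- a :* c) :* (b :* y :* (y :* y))) refl a b c M y ⟩
        (c * y) * ((c * y) * (c * y) - adj₁ a b c * (y * y)) + adj₂ a b c * (w * (y * y))
          ≈⟨ +-cong (*-cong cy≈1 (+-cong (*-cong cy≈1 cy≈1) (-‿cong (trans (*-congʳ y≈0) (zeroˡ _)))))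
               (trans (*-congʳ z≈0) (zeroˡ _)) ⟩
        1# * (1# * 1# - 0#) + 0#
          ≈⟨ solve 0 (:1 :* (:1 :* :1 :- :0) :+ :0 := :1) refl ⟩
        1# ∎
        where
        M+w≈ : M + w ≈ M * (c * y) + w
        M+w≈ = +-congʳ (trans (sym (*-identityʳ M)) (*-congˡ (sym cy≈1)))

    -- Multiplying the adjugate identity by `y` kills the adjugate; by independence its coordinates
    -- vanish, hence so do a, b, c. It serves twice: for inverses in the span and for nonzero norms
    -- along the orbit.
    norm≈0⇒≉invertible : norm a b c ≈ 0# → ∀ y → ¬ (⟪ a , b , c ⟫ * y ≈ 1#)
    norm≈0⇒≉invertible N≈0 y zy≈1 = <-irrefl
      (sym (1≈0 (coordinates≈0 (independent rat-adj₀ rat-adj₁ rat-adj₂ z*≈0)))) 0<1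
      where
      z* = ⟪ adj₀ a b c , adj₁ a b c , adj₂ a b c ⟫
      z*≈0 : z* ≈ 0#
      z*≈0 = begin
        z*                            ≈⟨ *-identityʳ z* ⟨
        z* * 1#                       ≈⟨ *-congˡ zy≈1 ⟨
        z* * (⟪ a , b , c ⟫ * y)      ≈⟨ solve 3 (λ s z y → s :* (z :* y) := (z :* s) :* y) refl z* _ y ⟩
        ⟪ a , b , c ⟫ * z* * y        ≈⟨ *-congʳ (trans (⟪⟫*adjugate a b c) N≈0) ⟩
        0# * y                        ≈⟨ zeroˡ y ⟩
        0#                            ∎
      1≈0 : a ≈ 0# × b ≈ 0# × c ≈ 0# → 1# ≈ 0#
      1≈0 (a≈0 , b≈0 , c≈0) = begin
        1#                          ≈⟨ zy≈1 ⟨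
        ⟪ a , b , c ⟫ * y           ≈⟨ *-congʳ (⟪⟫-cong a≈0 b≈0 c≈0) ⟩
        ⟪ 0# , 0# , 0# ⟫ * y        ≈⟨ solve 2 (λ t y → (:0 :+ :0 :* t :+ :0 :* (t :* t)) :* y := :0) refl θ y ⟩
        0#                          ∎
      coordinates≈0 : adj₀ a b c ≈ 0# × adj₁ a b c ≈ 0# × adj₂ a b c ≈ 0# → a ≈ 0# × b ≈ 0# × c ≈ 0#
      coordinates≈0 (x≈0 , y≈0 , z≈0) = adjugate≈0⇒≈0 x≈0 y≈0 z≈0

  record InSpan (x : ℝ) : Set where
    constructor mkSpan
    field
      {a b c} : ℝ
      rat-a   : Rational a
      rat-b   : Rational b
      rat-c   : Rational c
      x≈      : x ≈ ⟪ a , b , c ⟫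

  span-resp : ∀ {x y} → x ≈ y → InSpan x → InSpan y
  span-resp x≈y (mkSpan ra rb rc x≈) = mkSpan ra rb rc (trans (sym x≈y) x≈)

  span-+ : ∀ {x y} → InSpan x → InSpan y → InSpan (x + y)
  span-+ (mkSpan ra rb rc x≈) (mkSpan ra′ rb′ rc′ y≈) = mkSpan (rat-+ ra ra′) (rat-+ rb rb′) (rat-+ rc rc′)
    (trans (+-cong x≈ y≈) (solve 7 (λ a b c d e f t →
      (a :+ b :* t :+ c :* (t :* t)) :+ (d :+ e :* t :+ f :* (t :* t)) :=
      (a :+ d) :+ (b :+ e) :* t :+ (c :+ f) :* (t :* t)) refl _ _ _ _ _ _ θ))

  span-scale : ∀ {q x} → Rational q → InSpan x → InSpan (q * x)
  span-scale rq (mkSpan ra rb rc x≈) = mkSpan (rat-* rq ra) (rat-* rq rb) (rat-* rq rc)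
    (trans (*-congˡ x≈) (solve 5 (λ q a b c t →
      q :* (a :+ b :* t :+ c :* (t :* t)) := q :* a :+ (q :* b) :* t :+ (q :* c) :* (t :* t)) refl _ _ _ _ θ))

  span-θ : ∀ {x} → InSpan x → InSpan (θ * x)
  span-θ (mkSpan ra rb rc x≈) = mkSpan rc ra (rat-+ rb (rat-* rat-M rc)) (trans (*-congˡ x≈) (θ*⟪⟫ _ _ _))

  span-* : ∀ {x y} → InSpan x → InSpan y → InSpan (x * y)
  span-* {x} {y} (mkSpan {a} {b} {c} ra rb rc x≈) y∈ = span-resp eq
    (span-+ (span-+ (span-scale ra y∈) (span-scale rb (span-θ y∈))) (span-scale rc (span-θ (span-θ y∈))))
    where
    eq : a * y + b * (θ * y) + c * (θ * (θ * y)) ≈ x * y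
    eq = trans (solve 5 (λ a b c t y → a :* y :+ b :* (t :* y) :+ c :* (t :* (t :* y)) :=
      (a :+ b :* t :+ c :* (t :* t)) :* y) refl a b c θ y) (*-congʳ (sym x≈))

  rat⇒span : ∀ {q} → Rational q → InSpan q
  rat⇒span rq = mkSpan rq rat-0 rat-0 (solve 2 (λ q t → q := q :+ :0 :* t :+ :0 :* (t :* t)) refl _ θ)

  span-inverse : ∀ {x y} → InSpan x → x * y ≈ 1# → InSpan y
  span-inverse {x} {y} (mkSpan {a} {b} {c} ra rb rc x≈) xy≈1
    with rat-zero⊎invertible (rat-detℝ (rat-multiplication ra rb rc))
  ... | inj₁ N≈0 = ⊥-elim (norm≈0⇒≉invertible ra rb rc N≈0 y (trans (*-congʳ (sym x≈)) xy≈1))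
  ... | inj₂ (n , rn , Nn≈1) = span-resp eq (span-scale rn
          (mkSpan (rat-adj₀ ra rb rc) (rat-adj₁ ra rb rc) (rat-adj₂ ra rb rc) refl))
    where
    x* = ⟪ adj₀ a b c , adj₁ a b c , adj₂ a b c ⟫
    eq : n * x* ≈ y
    eq = begin
      n * x*                      ≈⟨ *-identityʳ _ ⟨
      n * x* * 1#                 ≈⟨ *-congˡ (trans (*-congʳ (sym x≈)) xy≈1) ⟨
      n * x* * (⟪ a , b , c ⟫ * y)
        ≈⟨ solve 4 (λ n s z y → n :* s :* (z :* y) := z :* s :* n :* y) refl n x* ⟪ a , b , c ⟫ y ⟩
      ⟪ a , b , c ⟫ * x* * n * y  ≈⟨ *-congʳ (trans (*-congʳ (⟪⟫*adjugate a b c)) Nn≈1) ⟩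
      1# * y                      ≈⟨ *-identityˡ y ⟩
      y                           ∎

  -- The case `inv` is the substantial one: inverses stay in the span because they are adjugates
  -- divided by norms.
  K⇒span : ∀ {x} → K x → InSpan x
  K⇒span generator        = mkSpan rat-0 rat-1 rat-0 (solve 1 (λ t → t := :0 :+ :1 :* t :+ :0 :* (t :* t)) refl θ)
  K⇒span one              = rat⇒span rat-1
  K⇒span (add p q)        = span-+ (K⇒span p) (K⇒span q)
  K⇒span (neg p)          = span-resp (solve 1 (λ x → :- :1 :* x := :- x) refl _) (span-scale (rat-neg rat-1) (K⇒span p))
  K⇒span (mul p q)        = span-* (K⇒span p) (K⇒span q)
  K⇒span (inv p xy≈1)     = span-inverse (K⇒span p) xy≈1
  K⇒span (resp x≈y p)     = span-resp x≈y (K⇒span p)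

  powers : Vector ℝ 3
  powers = 1# ∷ θ ∷ θ * θ ∷ []

  combination≈ : ∀ (q : Vector ℚ 3) {e : Vector ℝ 3} → (∀ i → fromℚ (q i) ≈ e i) →
                 combination q powers ≈ ⟪ e 0F , e 1F , e 2F ⟫
  combination≈ q {e} q≈e = begin
    fromℚ (q 0F) * 1# + (fromℚ (q 1F) * θ + (fromℚ (q 2F) * (θ * θ) + 0#))
      ≈⟨ +-cong (*-congʳ (q≈e 0F)) (+-cong (*-congʳ (q≈e 1F)) (+-congʳ (*-congʳ (q≈e 2F)))) ⟩
    e 0F * 1# + (e 1F * θ + (e 2F * (θ * θ) + 0#))
      ≈⟨ solve 4 (λ a b c t → a :* :1 :+ (b :* t :+ (c :* (t :* t) :+ :0)) := a :+ b :* t :+ c :* (t :* t)) refl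
           (e 0F) (e 1F) (e 2F) θ ⟩
    ⟪ e 0F , e 1F , e 2F ⟫ ∎

  powers-isBasis : IsBasis K powers
  powers-isBasis = record
    { member      = λ { 0F → one ; 1F → generator ; 2F → mul generator generator }
    ; independent = λ q q≈0 → components q (independent (q 0F , refl) (q 1F , refl) (q 2F , refl)
                      (trans (sym (combination≈ q (λ _ → refl))) q≈0))
    ; spanning    = λ x∈K → spans (K⇒span x∈K)
    }
    where
    components : ∀ (q : Vector ℚ 3) → fromℚ (q 0F) ≈ 0# × fromℚ (q 1F) ≈ 0# × fromℚ (q 2F) ≈ 0# → ∀ i → q i ≡ 0ℚ
    components q (p₀ , p₁ , p₂) 0F = fromℚ≈0⇒≡0 (q 0F) p₀
    components q (p₀ , p₁ , p₂) 1F = fromℚ≈0⇒≡0 (q 1F) p₁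
    components q (p₀ , p₁ , p₂) 2F = fromℚ≈0⇒≡0 (q 2F) p₂
    spans : ∀ {x} → InSpan x → ∃[ q ] x ≈ combination q powers
    spans (mkSpan {a} {b} {c} (p , p≈) (q , q≈) (r , r≈) x≈) = p ∷ q ∷ r ∷ [] ,
      trans x≈ (sym (combination≈ (p ∷ q ∷ r ∷ []) {a ∷ b ∷ c ∷ []} λ { 0F → p≈ ; 1F → q≈ ; 2F → r≈ }))

  -- The rational witness assembled by `rat-detℝ` follows the formula of `det`, so it is `det Q` by
  -- computation.
  fromℚ-det : ∀ (Q : Fin 3 → Fin 3 → ℚ) {E : Fin 3 → Vector ℝ 3} → (∀ i j → fromℚ (Q i j) ≈ E i j) →
              fromℚ (det Q) ≈ detℝ E
  fromℚ-det Q {E} Q≈E = proj₂ (rat-detℝ (λ i j → Q i j , Q≈E i j))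

  abstract
    hasNorm : ∀ {x a b c} (ra : Rational a) (rb : Rational b) (rc : Rational c) → x ≈ ⟪ a , b , c ⟫ →
              ∃[ n ] fromℚ n ≈ norm a b c × IsNorm K x n
    hasNorm {x} {a} {b} {c} ra rb rc x≈ = det Q , fromℚ-det Q Q≈ , record
      { basis       = powers
      ; isBasis     = powers-isBasis
      ; matrix      = Q
      ; represents  = λ i → trans (row i) (sym (combination≈ (Q i) {multiplication a b c i} (Q≈ i)))
      ; determinant = ≡.refl
      }
      where
      Q : Fin 3 → Fin 3 → ℚ
      Q i j = proj₁ (rat-multiplication ra rb rc i j)
      Q≈ : ∀ i j → fromℚ (Q i j) ≈ multiplication a b c i j
      Q≈ i j = proj₂ (rat-multiplication ra rb rc i j)
      E : Fin 3 → Vector ℝ 3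
      E = multiplication a b c
      row : ∀ i → x * powers i ≈ ⟪ E i 0F , E i 1F , E i 2F ⟫
      row 0F = trans (*-identityʳ x) x≈
      row 1F = trans (*-comm x θ) (trans (*-congˡ x≈) (θ*⟪⟫ a b c))
      row 2F = begin
        x * (θ * θ)              ≈⟨ solve 2 (λ x t → x :* (t :* t) := t :* (t :* x)) refl x θ ⟩
        θ * (θ * x)              ≈⟨ *-congˡ (trans (*-congˡ x≈) (θ*⟪⟫ a b c)) ⟩
        θ * ⟪ c , a , b + M * c ⟫ ≈⟨ θ*⟪⟫ c a (b + M * c) ⟩
        ⟪ E 2F 0F , E 2F 1F , E 2F 2F ⟫ ∎

  private
    :norm : ∀ {n} → (m a b c : Polynomial n) → Polynomial n
    :norm m a b c =
      let r = b :+ m :* c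
          s = a :+ m :* r
      in a :* (a :* s :- r :* c) :- b :* (c :* s :- r :* r) :+ c :* (c :* c :- a :* r)

  -- The left side is the norm of θ times the element, and N(θ) = 1 because the constant term of the
  -- cubic is -1.
  norm-θ : ∀ a b c → norm c a (b + M * c) ≈ norm a b c
  norm-θ a b c = solve 4 (λ a b c m → :norm m c a (b :+ m :* c) := :norm m a b c) refl a b c M

  -- Multiplicativity of the norm for the factor θ - k, whose norm is minus the cubic evaluated at
  -- k.
  norm-[θ-k] : ∀ k a b c → norm (c - k * a) (a - k * b) (b + M * c - k * c) ≈ norm a b c * (k * k * (M - k) + 1#)
  norm-[θ-k] k a b c = solve 5 (λ a b c m k → :norm m (c :- k :* a) (a :- k :* b) (b :+ m :* c :- k :* c) :=
    :norm m a b c :* (k :* k :* (m :- k) :+ :1)) refl a b c M k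

  [θ-k]*⟪⟫ : ∀ k a b c → (θ - k) * ⟪ a , b , c ⟫ ≈ ⟪ c - k * a , a - k * b , b + M * c - k * c ⟫
  [θ-k]*⟪⟫ k a b c = begin
    (θ - k) * ⟪ a , b , c ⟫                ≈⟨ solve 3 (λ t k x → (t :- k) :* x := t :* x :- k :* x) refl θ k _ ⟩
    θ * ⟪ a , b , c ⟫ - k * ⟪ a , b , c ⟫  ≈⟨ +-congʳ (θ*⟪⟫ a b c) ⟩
    ⟪ c , a , b + M * c ⟫ - k * ⟪ a , b , c ⟫
      ≈⟨ solve 6 (λ a b c t m k → (c :+ a :* t :+ (b :+ m :* c) :* (t :* t)) :- k :* (a :+ b :* t :+ c :* (t :* t)) :=
           (c :- k :* a) :+ (a :- k :* b) :* t :+ (b :+ m :* c :- k :* c) :* (t :* t)) refl a b c θ M k ⟩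
    ⟪ c - k * a , a - k * b , b + M * c - k * c ⟫ ∎

-- The three phases of the orbit and the integer inequality behind the choice of pair.

-- In each of the three phases of the orbit the barycentric coordinates 0, 1, 2
-- = γ, α, β play the roles of the small, the middle and the big one; a step
-- subtracts the middle one from the big one.
Phase : Set
Phase = Fin 3

small mid big : Phase → Fin 3
small 0F = 1F
small 1F = 0F
small 2F = 2F
mid 0F = 2F
mid 1F = 1F
mid 2F = 0F
big 0F = 0F
big 1F = 2F
big 2F = 1F

-- In every phase the three roles exhaust the indices, so statements about all coordinates can be
-- proved role by role, uniformly in the phase.
byRole : ∀ {ℓ} c {P : Fin 3 → Set ℓ} → P (small c) → P (mid c) → P (big c) → ∀ i → P i
byRole 0F s μ b 0F = b
byRole 0F s μ b 1F = s
byRole 0F s μ b 2F = μ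
byRole 1F s μ b 0F = s
byRole 1F s μ b 1F = μ
byRole 1F s μ b 2F = b
byRole 2F s μ b 0F = μ
byRole 2F s μ b 1F = b
byRole 2F s μ b 2F = s

module _ {A : Set} (s μ b : A) where
  arrange : Phase → Vector A 3
  arrange c = byRole c s μ b

  arrange-small : ∀ c → arrange c (small c) ≡ s
  arrange-small 0F = ≡.refl
  arrange-small 1F = ≡.refl
  arrange-small 2F = ≡.refl

  arrange-mid : ∀ c → arrange c (mid c) ≡ μ
  arrange-mid 0F = ≡.refl
  arrange-mid 1F = ≡.refl
  arrange-mid 2F = ≡.refl

  arrange-big : ∀ c → arrange c (big c) ≡ b
  arrange-big 0F = ≡.refl
  arrange-big 1F = ≡.refl
  arrange-big 2F = ≡.refl

-- After m subtractions the big coordinate has become the smallest: the old big, small and middle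
-- ones turn into the new small, middle and big ones.
next : Phase → Phase
next 0F = 1F
next 1F = 2F
next 2F = 0F

-- The ordered pair (`big c`, `mid c`), since T_(i,j) subtracts coordinate j from coordinate i and
-- renormalises.
direction : Phase → Ind
direction 0F = ⟨0,2⟩
direction 1F = ⟨2,1⟩
direction 2F = ⟨1,0⟩

-- Here m²e - k²e = e³ + 2ke² ≥ 1, so n ≤ m²e. Squaring gives m⁴e², which falls short of (me)⁵ by
-- the factor me³ ≥ 1.
norm-bound : ∀ k d → let e = suc d ; m = k ℕ.+ e ; n = k ℕ.* k ℕ.* e ℕ.+ 1 in
             n ℕ.* n ℕ.≤ (m ℕ.* e) ℕ.^ 5
norm-bound k d = begin
  n ℕ.* n                          ≤⟨ ℕ.*-mono-≤ n≤mme n≤mme ⟩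
  mme ℕ.* mme                      ≡⟨ ℕ.*-identityʳ (mme ℕ.* mme) ⟨
  mme ℕ.* mme ℕ.* 1                ≤⟨ ℕ.*-monoʳ-≤ (mme ℕ.* mme) 1≤meee ⟩
  mme ℕ.* mme ℕ.* (m ℕ.* e ℕ.* e ℕ.* e)
    ≡⟨ solve 2 (λ m e → m :* m :* e :* (m :* m :* e) :* (m :* e :* e :* e) := (m :* e) :^ 5) ≡.refl m e ⟩
  (m ℕ.* e) ℕ.^ 5                  ∎
  where
  open ℕ.+-*-Solver
  open ℕ.≤-Reasoning
  e = suc d
  m = k ℕ.+ e
  n = k ℕ.* k ℕ.* e ℕ.+ 1
  mme = m ℕ.* m ℕ.* e
  1≤e : 1 ℕ.≤ e
  1≤e = s≤s z≤n
  1≤m : 1 ℕ.≤ m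
  1≤m = ℕ.≤-trans 1≤e (ℕ.m≤n+m e k)
  1≤meee : 1 ℕ.≤ m ℕ.* e ℕ.* e ℕ.* e
  1≤meee = ℕ.*-mono-≤ (ℕ.*-mono-≤ (ℕ.*-mono-≤ 1≤m 1≤e) 1≤e) 1≤e
  1≤eee : 1 ℕ.≤ e ℕ.* e ℕ.* e
  1≤eee = ℕ.*-mono-≤ (ℕ.*-mono-≤ 1≤e 1≤e) 1≤e
  n≤mme : n ℕ.≤ mme
  n≤mme = begin
    k ℕ.* k ℕ.* e ℕ.+ 1                              ≤⟨ ℕ.+-monoʳ-≤ (k ℕ.* k ℕ.* e) 1≤eee ⟩
    k ℕ.* k ℕ.* e ℕ.+ e ℕ.* e ℕ.* e                  ≤⟨ ℕ.m≤m+n _ (2 ℕ.* (k ℕ.* e ℕ.* e)) ⟩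
    k ℕ.* k ℕ.* e ℕ.+ e ℕ.* e ℕ.* e ℕ.+ 2 ℕ.* (k ℕ.* e ℕ.* e)
      ≡⟨ solve 2 (λ k e → k :* k :* e :+ e :* e :* e :+ con 2 :* (k :* e :* e) := (k :+ e) :* (k :+ e) :* e) ≡.refl k e ⟩
    mme ∎

-- One step of the algorithm in homogeneous barycentric coordinates.

module Barycentric (R : RealNumbers) where
  open ContinuedFraction R
  open RealLemmas R
  open IntegerCoefficients commutativeRing
  open SetoidReasoning setoid

  -- (γ : α : β) is, up to the positive factor t, the arrangement of s, μ, b given by c.
  record Homogeneous (c : Phase) (p : Point) (s μ b : ℝ) : Set where
    field
      t     : ℝ
      0<t   : 0# < t
      smallᵗ : coordinate p (small c) ≈ t * s
      midᵗ   : coordinate p (mid c) ≈ t * μ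
      bigᵗ   : coordinate p (big c) ≈ t * b

  homogeneous-resp : ∀ {c p s s′ μ μ′ b b′} → s ≈ s′ → μ ≈ μ′ → b ≈ b′ →
                     Homogeneous c p s μ b → Homogeneous c p s′ μ′ b′
  homogeneous-resp s≈ μ≈ b≈ h = record
    { t = t ; 0<t = 0<t ; smallᵗ = trans smallᵗ (*-congˡ s≈) ; midᵗ = trans midᵗ (*-congˡ μ≈) ; bigᵗ = trans bigᵗ (*-congˡ b≈) }
    where open Homogeneous h

  coordinates-sum : ∀ p c → coordinate p (small c) + coordinate p (mid c) + coordinate p (big c) ≈ 1#
  coordinates-sum (α , β) 0F = solve 2 (λ a b → a :+ b :+ (:1 :- a :- b) := :1) refl α β
  coordinates-sum (α , β) 1F = solve 2 (λ a b → (:1 :- a :- b) :+ a :+ b := :1) refl α β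
  coordinates-sum (α , β) 2F = solve 2 (λ a b → b :+ (:1 :- a :- b) :+ a := :1) refl α β

  -- Barycentric coordinates sum to 1, so the scale is the inverse of s + μ + b. From this come
  -- `t ∈ K`, the uniqueness of the point, and the nonzero norm of `t`.
  t[s+μ+b]≈1 : ∀ {c p s μ b} (h : Homogeneous c p s μ b) → Homogeneous.t h * (s + μ + b) ≈ 1#
  t[s+μ+b]≈1 {c} {p} {s} {μ} {b} h = begin
    t * (s + μ + b)          ≈⟨ solve 4 (λ t s μ b → t :* (s :+ μ :+ b) := t :* s :+ t :* μ :+ t :* b) refl t s μ b ⟩
    t * s + t * μ + t * b    ≈⟨ +-cong (+-cong smallᵗ midᵗ) bigᵗ ⟨
    coordinate p (small c) + coordinate p (mid c) + coordinate p (big c) ≈⟨ coordinates-sum p c ⟩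
    1#                       ∎
    where open Homogeneous h

  coordinates-≈ : ∀ {p q} → (∀ i → coordinate p i ≈ coordinate q i) → p ≈ₚ q
  coordinates-≈ eq = eq 1F , eq 2F

  homogeneous-unique : ∀ {c p q s μ b} → 0# < s → 0# < μ → 0# < b →
                       Homogeneous c p s μ b → Homogeneous c q s μ b → p ≈ₚ q
  homogeneous-unique {c} {p} {q} {s} {μ} {b} 0<s 0<μ 0<b h h′ =
    coordinates-≈ {p} {q} (byRole c (eq smallᵗ smallᵗ′) (eq midᵗ midᵗ′) (eq bigᵗ bigᵗ′))
    where
    open Homogeneous h
    open Homogeneous h′ using () renaming (t to t′; smallᵗ to smallᵗ′; midᵗ to midᵗ′; bigᵗ to bigᵗ′)
    t≈t′ : t ≈ t′
    t≈t′ = *-cancelˡ-pos (0<x+y′ (0<x+y′ 0<s 0<μ) 0<b)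
      (trans (*-comm _ t) (trans (t[s+μ+b]≈1 h) (trans (sym (t[s+μ+b]≈1 h′)) (*-comm t′ _))))
    eq : ∀ {x y z} → x ≈ t * z → y ≈ t′ * z → x ≈ y
    eq x≈ y≈ = trans x≈ (trans (*-congʳ t≈t′) (sym y≈))

  α+β<1 : ∀ {p@(α , β) : Point} → 0# < coordinate p 0F → α + β < 1#
  α+β<1 {α , β} 0<γ = 0<y-x⇒x<y (<-respʳ-≈ (solve 2 (λ a b → :1 :- a :- b := :1 :- (a :+ b)) refl α β) 0<γ)

  coordinate>0⇒Δ : ∀ {p} → (∀ i → 0# < coordinate p i) → Δ p
  coordinate>0⇒Δ {p} pos = mkΔ (<⇒≤ (pos 1F)) (<⇒≤ (pos 2F)) (<⇒≤ (α+β<1 {p} (pos 0F)))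

  module Subtraction {c p s μ b} (h : Homogeneous c p s μ b) (0<s : 0# < s) (0<μ : 0# < μ) (μ<b : μ < b) where
    open Homogeneous h

    0<coordinate : ∀ i → 0# < coordinate p i
    0<coordinate = byRole c {λ i → 0# < coordinate p i}
      (<-respʳ-≈ (sym smallᵗ) (*-pos 0<t 0<s))
      (<-respʳ-≈ (sym midᵗ) (*-pos 0<t 0<μ))
      (<-respʳ-≈ (sym bigᵗ) (*-pos 0<t (<-trans 0<μ μ<b)))

    mid<big : coordinate p (mid c) < coordinate p (big c)
    mid<big = <-respˡ-≈ (sym midᵗ) (<-respʳ-≈ (sym bigᵗ) (*-monoʳ-< 0<t μ<b))

    Δp : Δ p
    Δp = coordinate>0⇒Δ 0<coordinate

  -- The linear forms that cut out the triangles are differences of barycentric coordinates, for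
  -- example γ - β = 1 - α - 2β and α - γ = 2α + β - 1.
  △-direction : ∀ c {p} → Δ p → coordinate p (mid c) < coordinate p (big c) → △ (direction c) p
  △-direction 0F {α , β} Δp β<γ = Δp , λ 0<σ → <-irrefl refl (<-trans (x<y⇒0<y-x β<γ)
    (<-respˡ-≈ (sym (eq α β)) (<-respʳ-≈ -0≈0 (0<⇒-<0 0<σ))))
    where
    eq : ∀ α β → (1# - α - β) - β ≈ - (α + 2# * β - 1#)
    eq = solve 2 (λ a b → (:1 :- a :- b) :- b := :- (a :+ (:1 :+ :1) :* b :- :1)) refl
    -0≈0 : - 0# ≈ 0#
    -0≈0 = solve 0 (:- :0 := :0) refl
    0<⇒-<0 : ∀ {x} → 0# < x → - x < - 0#
    0<⇒-<0 {x} 0<x = 0<y-x⇒x<y (<-respʳ-≈ (solve 1 (λ x → x := :- :0 :- :- x) refl x) 0<x)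
  △-direction 1F Δp α<β = Δp , <⇒≤ α<β
  △-direction 2F {α , β} Δp γ<α = Δp , <⇒≤ (<-respʳ-≈ eq (x<y⇒0<y-x γ<α))
    where
    eq : α - (1# - α - β) ≈ 2# * α + β - 1#
    eq = solve 2 (λ a b → a :- (:1 :- a :- b) := (:1 :+ :1) :* a :+ b :- :1) refl α β

  -- T (direction c) p is the case where e is the inverse of the denominator.
  scaled : Phase → Point → ℝ → Point
  scaled c p e = proj₁ (numerators (direction c) p) * e , proj₂ (numerators (direction c) p) * e

  -- In each phase the denominator is 1 minus the middle coordinate, the total that is left after
  -- the subtraction. The 1 inside the new γ is replaced by denominator times `e`, so that all three
  -- coordinates share the factor `e`.
  scaled-coordinates : ∀ c p {e} → denominator (direction c) p * e ≈ 1# →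
    coordinate (scaled c p e) (small c) ≈ e * coordinate p (small c) ×
    coordinate (scaled c p e) (mid c) ≈ e * coordinate p (mid c) ×
    coordinate (scaled c p e) (big c) ≈ e * (coordinate p (big c) - coordinate p (mid c))
  scaled-coordinates 0F (α , β) {e} de≈1 = *-comm α e , *-comm β e ,
    trans (+-congʳ (+-congʳ (sym de≈1)))
      (solve 3 (λ a b e → (:1 :- b) :* e :- a :* e :- b :* e := e :* ((:1 :- a :- b) :- b)) refl α β e)
  scaled-coordinates 1F (α , β) {e} de≈1 =
    trans (+-congʳ (+-congʳ (sym de≈1)))
      (solve 3 (λ a b e → (:1 :- a) :* e :- a :* e :- (b :- a) :* e := e :* (:1 :- a :- b)) refl α β e) ,
    *-comm α e , *-comm _ e
  scaled-coordinates 2F (α , β) {e} de≈1 = *-comm β e ,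
    trans (+-congʳ (+-congʳ (sym de≈1)))
      (solve 3 (λ a b e → (a :+ b) :* e :- ((:1 :+ :1) :* a :+ b :- :1) :* e :- b :* e := e :* (:1 :- a :- b)) refl α β e) ,
    solve 3 (λ a b e → ((:1 :+ :1) :* a :+ b :- :1) :* e := e :* (a :- (:1 :- a :- b))) refl α β e

  homogeneous-scaled : ∀ {c p s μ b e} → 0# < e → denominator (direction c) p * e ≈ 1# →
                       Homogeneous c p s μ b → Homogeneous c (scaled c p e) s μ (b - μ)
  homogeneous-scaled {c} {p} {s} {μ} {b} {e} 0<e de≈1 h = record
    { t      = e * t
    ; 0<t    = *-pos 0<e 0<t
    ; smallᵗ = trans (proj₁ eqs) (trans (*-congˡ smallᵗ) (sym (*-assoc e t s)))
    ; midᵗ   = trans (proj₁ (proj₂ eqs)) (trans (*-congˡ midᵗ) (sym (*-assoc e t μ)))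
    ; bigᵗ   = trans (proj₂ (proj₂ eqs)) (trans (*-congˡ (+-cong bigᵗ (-‿cong midᵗ)))
        (solve 4 (λ e t b μ → e :* (t :* b :- t :* μ) := e :* t :* (b :- μ)) refl e t b μ))
    }
    where
    open Homogeneous h
    eqs = scaled-coordinates c p de≈1

  homogeneous-T : ∀ {c p s μ b} (p∈△ : △ (direction c) p) →
                  Homogeneous c p s μ b → Homogeneous c (T (direction c) p p∈△) s μ (b - μ)
  homogeneous-T {c} p∈△ = homogeneous-scaled {c} (0<inverse 0<d) (proj₂ (inverse 0<d))
    where 0<d = 0<denominator (direction c) p∈△

  module Weights (p : Point) (n : Vector ℚ 3) (n≢0 : ∀ i → n i ≢ 0ℚ) (0<coordinate : ∀ i → 0# < coordinate p i) where
    weight : Fin 3 → ℝ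
    weight i = coordinate p i ^5/2 * 1/∣ n i ∣

    0<weight : ∀ i → 0# < weight i
    0<weight i = *-pos (0<√x (0<x^n 5 (0<coordinate i))) (0<1/∣q∣ (n≢0 i))

    private
      product : ∀ i j → coordinate p i ^5/2 * coordinate p j ^5/2 * 1/∣ n i ℚ.* n j ∣ ≈ weight i * weight j
      product i j = trans (*-congˡ (1/∣pq∣ (n≢0 i) (n≢0 j)))
        (solve 4 (λ g h x y → g :* h :* (x :* y) := (g :* x) :* (h :* y)) refl _ _ 1/∣ n i ∣ 1/∣ n j ∣)

      comm : ∀ {x y z} → x ≈ y * z → x ≈ z * y
      comm eq = trans eq (*-comm _ _)

      compare : ∀ {v w i j k} → v ≈ weight k * weight i → w ≈ weight k * weight j → weight i < weight j → v < w
      compare v≈ w≈ i<j = <-respˡ-≈ (sym v≈) (<-respʳ-≈ (sym w≈) (*-monoʳ-< (0<weight _) i<j))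

    -- The value of a pair is the product of two positive weights. Any two pairs share an index, and
    -- cancelling its weight shows that the best pair omits the smallest weight.
    unique-maximum : ∀ c → weight (small c) < weight (mid c) → weight (small c) < weight (big c) →
                     ∀ P → P ≢ unordered (direction c) → v p n P < v p n (unordered (direction c))
    unique-maximum 0F s<μ s<b ｛1,2｝ _ = compare (comm (product 1F 2F)) (comm (product 0F 2F)) s<b
    unique-maximum 0F s<μ s<b ｛0,1｝ _ = compare (product 0F 1F) (product 0F 2F) s<μ
    unique-maximum 0F s<μ s<b ｛0,2｝ P≢ = ⊥-elim (P≢ ≡.refl)
    unique-maximum 1F s<μ s<b ｛1,2｝ P≢ = ⊥-elim (P≢ ≡.refl)
    unique-maximum 1F s<μ s<b ｛0,1｝ _ = compare (comm (product 0F 1F)) (product 1F 2F) s<b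
    unique-maximum 1F s<μ s<b ｛0,2｝ _ = compare (comm (product 0F 2F)) (comm (product 1F 2F)) s<μ
    unique-maximum 2F s<μ s<b ｛1,2｝ _ = compare (product 1F 2F) (comm (product 0F 1F)) s<μ
    unique-maximum 2F s<μ s<b ｛0,1｝ P≢ = ⊥-elim (P≢ ≡.refl)
    unique-maximum 2F s<μ s<b ｛0,2｝ _ = compare (product 0F 2F) (product 0F 1F) s<b

    -- Only the ratio δ of the two norms matters: the inequality between the roots is divided by |n
    -- i| and |δ|.
    weight-< : ∀ {i j δ D} → n j ≡ n i ℚ.* δ → δ ≢ 0ℚ → fromℚ ℚ.∣ δ ∣ ≈ D → 0# < D →
               coordinate p i ^ 5 * (D * D) < coordinate p j ^ 5 → weight i < weight j
    weight-< {i} {j} {δ} {D} nj≡ δ≢0 ∣δ∣≈D 0<D x^5D²<y^5 =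
      <-respˡ-≈ lhs (<-respʳ-≈ rhs (*-monoʳ-< (*-pos (0<1/∣q∣ (n≢0 i)) (0<1/∣q∣ δ≢0))
        (√x*d<√y (0<x^n 5 (0<coordinate i)) 0<D x^5D²<y^5)))
      where
      r = 1/∣ n i ∣
      r′ = 1/∣ δ ∣
      lhs : r * r′ * (coordinate p i ^5/2 * D) ≈ weight i
      lhs = trans (solve 4 (λ r s g d → r :* s :* (g :* d) := g :* r :* (d :* s)) refl r r′ _ D)
        (trans (*-congˡ (trans (*-congʳ (sym ∣δ∣≈D)) (∣q∣*1/∣q∣≈1 δ≢0))) (*-identityʳ _))
      rhs : r * r′ * coordinate p j ^5/2 ≈ weight j
      rhs = trans (*-comm _ _) (*-congˡ (trans (sym (1/∣pq∣ (n≢0 i) δ≢0)) (reflexive (≡.cong 1/∣_∣ (≡.sym nj≡)))))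

small-next : ∀ c → small (next c) ≡ big c
small-next 0F = ≡.refl
small-next 1F = ≡.refl
small-next 2F = ≡.refl

mid-next : ∀ c → mid (next c) ≡ small c
mid-next 0F = ≡.refl
mid-next 1F = ≡.refl
mid-next 2F = ≡.refl

big-next : ∀ c → big (next c) ≡ mid c
big-next 0F = ≡.refl
big-next 1F = ≡.refl
big-next 2F = ≡.refl

-- The orbit of the starting point.

module Orbit (R : RealNumbers) (m : ℕ) (m>0 : m > 0)
  (θ : RealNumbers.Carrier R) (isRoot : CubicField.IsRoot R m m>0 θ) where
  open ContinuedFraction R
  open CubicField R m m>0
  open CommutativeRing commutativeRing using (semiring; commutativeSemiring)
  open RealLemmas R
  open Rationals R
  open PowerBasis R m m>0 θ isRoot
  open Barycentric R
  open IntegerCoefficients commutativeRing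
  open SetoidReasoning setoid

  M<θ : M < θ
  M<θ = root>m isRoot

  1<θ : 1# < θ
  1<θ = ≤-<-trans 1≤M M<θ

  0<θ : 0# < θ
  0<θ = <-trans 0<1 1<θ

  bigAt : ℕ → ℝ
  bigAt k = θ * (θ - fromℕ k)

  K-0 : K 0#
  K-0 = resp (-‿inverseʳ 1#) (add one (neg one))

  K-fromℕ : ∀ k → K (fromℕ k)
  K-fromℕ zero    = K-0
  K-fromℕ (suc k) = add one (K-fromℕ k)

  K-bigAt : ∀ k → K (bigAt k)
  K-bigAt k = mul generator (add generator (neg (K-fromℕ k)))

  -- The passage from 1, θ, θ² to 1, θ, θ(θ - k) is unitriangular: the coefficient of θ becomes b -
  -- kc.
  rational-independent : ∀ k {a b c} → Rational a → Rational b → Rational c →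
    a * 1# + b * θ + c * bigAt k ≈ 0# → a ≈ 0# × b ≈ 0# × c ≈ 0#
  rational-independent k {a} {b} {c} ra rb rc eq =
    unshift (independent ra (rat-+ rb (rat-neg (rat-* (rat-fromℕ k) rc))) rc
      (trans (solve 5 (λ a b c t k → a :+ (b :- k :* c) :* t :+ c :* (t :* t) :=
        a :* :1 :+ b :* t :+ c :* (t :* (t :- k))) refl a b c θ (fromℕ k)) eq))
    where
    unshift : a ≈ 0# × b - fromℕ k * c ≈ 0# × c ≈ 0# → a ≈ 0# × b ≈ 0# × c ≈ 0#
    unshift (a≈0 , b-kc≈0 , c≈0) = a≈0 , (begin
      b                                  ≈⟨ solve 3 (λ b c k → b := (b :- k :* c) :+ k :* c) refl b c (fromℕ k) ⟩
      (b - fromℕ k * c) + fromℕ k * c    ≈⟨ +-cong b-kc≈0 (trans (*-congˡ c≈0) (zeroʳ _)) ⟩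
      0# + 0#                            ≈⟨ +-identityʳ 0# ⟩
      0#                                 ∎) , c≈0

  -- Presenting m - k as `suc d` encodes k < m and avoids truncated subtraction.
  module _ (k d : ℕ) (k+1+d≡m : k ℕ.+ suc d ≡ m) where
    private
      e = suc d
      n = k ℕ.* k ℕ.* e ℕ.+ 1

    M-k≈e : M - fromℕ k ≈ fromℕ e
    M-k≈e = trans (+-congʳ (trans (reflexive (≡.cong fromℕ (≡.sym k+1+d≡m))) (fromℕ-+ k e)))
      (solve 2 (λ k e → k :+ e :- k := e) refl (fromℕ k) (fromℕ e))

    e<θ-k : fromℕ e < θ - fromℕ k
    e<θ-k = <-respˡ-≈ M-k≈e (+-monoˡ-< (- fromℕ k) M<θ)

    0<M : 0# < M
    0<M = <-≤-trans 0<1 1≤M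

    θ<big : θ < bigAt k
    θ<big = <-respˡ-≈ (*-identityʳ θ) (*-monoʳ-< 0<θ (≤-<-trans 1≤e e<θ-k))
      where
      1≤e : 1# ≤ fromℕ e
      1≤e p = fromℕ-mono-≤ {1} {e} (s≤s z≤n) (<-respʳ-≈ (sym (+-identityʳ 1#)) p)

    -- The strictness comes from M < θ and e < θ - k; the integer bound itself is only weak.
    n²<big^5 : fromℕ n * fromℕ n < bigAt k ^ 5
    n²<big^5 = ≤-<-trans n²≤ (^-monoˡ-< 4 (*-pos 0<M (0<fromℕ[1+n] d))
      (*-mono-< 0<θ (0<fromℕ[1+n] d) M<θ e<θ-k))
      where
      n²≤ : fromℕ n * fromℕ n ≤ (M * fromℕ e) ^ 5
      n²≤ p = fromℕ-mono-≤ (≡.subst (λ m → n ℕ.* n ℕ.≤ (m ℕ.* e) ℕ.^ 5) k+1+d≡m (norm-bound k d))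
        (<-respˡ-≈ (sym (trans (fromℕ-^ (m ℕ.* e) 5) (Exp.^-congˡ semiring 5 (fromℕ-* m e))))
          (<-respʳ-≈ (sym (fromℕ-* n n)) p))

    fromℕ-n : fromℕ k * fromℕ k * (M - fromℕ k) + 1# ≈ fromℕ n
    fromℕ-n = sym (trans (fromℕ-+ (k ℕ.* k ℕ.* e) 1) (+-cong
      (trans (fromℕ-* (k ℕ.* k) e) (*-cong (fromℕ-* k k) (sym M-k≈e))) (+-identityʳ 1#)))

    private
      δ : ℚ
      δ = proj₁ (rat-fromℕ n)
      δ≈n : fromℚ δ ≈ fromℕ n
      δ≈n = proj₂ (rat-fromℕ n)
      0<n : 0# < fromℕ n
      0<n = <-respʳ-≈ (reflexive (≡.cong fromℕ (ℕ.+-comm 1 (k ℕ.* k ℕ.* e)))) (0<fromℕ[1+n] (k ℕ.* k ℕ.* e))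
      δ≢0 : δ ≢ 0ℚ
      δ≢0 δ≡0 = <-irrefl (sym (trans (sym δ≈n) (trans (reflexive (≡.cong fromℚ δ≡0)) fromℚ-0))) 0<n

    module _ {c : Phase} {p : Point} (h : Homogeneous c p 1# θ (bigAt k)) where
      open Homogeneous h
      open Subtraction h 0<1 0<θ θ<big

      t∈K : K t
      t∈K = inv (add (add one generator) (K-bigAt k)) (trans (*-comm _ t) (t[s+μ+b]≈1 h))

      coordinate∈K : ∀ i → K (coordinate p i)
      coordinate∈K = byRole c (resp (sym smallᵗ) (mul t∈K one)) (resp (sym midᵗ) (mul t∈K generator))
        (resp (sym bigᵗ) (mul t∈K (K-bigAt k)))

      coordinates-independent : ∀ (f : Fin 3 → ℝ) → (∀ i → Rational (f i)) →
        f (small c) * coordinate p (small c) + f (mid c) * coordinate p (mid c) + f (big c) * coordinate p (big c) ≈ 0# →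
        ∀ i → f i ≈ 0#
      coordinates-independent f rf eq = zeros (rational-independent k (rf (small c)) (rf (mid c)) (rf (big c))
        (*-cancelˡ-pos 0<t (begin
          t * (f (small c) * 1# + f (mid c) * θ + f (big c) * bigAt k)
            ≈⟨ solve 7 (λ t x y z a b c → t :* (x :* a :+ y :* b :+ z :* c) :=
                 x :* (t :* a) :+ y :* (t :* b) :+ z :* (t :* c)) refl t _ _ _ 1# θ (bigAt k) ⟩
          f (small c) * (t * 1#) + f (mid c) * (t * θ) + f (big c) * (t * bigAt k)
            ≈⟨ +-cong (+-cong (*-congˡ smallᵗ) (*-congˡ midᵗ)) (*-congˡ bigᵗ) ⟨
          f (small c) * coordinate p (small c) + f (mid c) * coordinate p (mid c) + f (big c) * coordinate p (big c)
            ≈⟨ trans eq (sym (zeroʳ t)) ⟩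
          t * 0# ∎)))
        where
        zeros : f (small c) ≈ 0# × f (mid c) ≈ 0# × f (big c) ≈ 0# → ∀ i → f i ≈ 0#
        zeros (s≈0 , μ≈0 , b≈0) = byRole c s≈0 μ≈0 b≈0

      inΔ[K] : Δ[ K ] p
      inΔ[K] = record
        { α∈K         = coordinate∈K 1F
        ; β∈K         = coordinate∈K 2F
        ; independent = 1αβ-independent
        ; 0<α         = 0<coordinate 1F
        ; 0<β         = 0<coordinate 2F
        ; α+β<1       = α+β<1 {p} (0<coordinate 0F)
        }
        where
        byRole-sum : ∀ c (g : Fin 3 → ℝ) → g (small c) + g (mid c) + g (big c) ≈ g 0F + g 1F + g 2F
        byRole-sum 0F g = solve 3 (λ x y z → y :+ z :+ x := x :+ y :+ z) refl (g 0F) (g 1F) (g 2F)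
        byRole-sum 1F g = refl
        byRole-sum 2F g = solve 3 (λ x y z → z :+ x :+ y := x :+ y :+ z) refl (g 0F) (g 1F) (g 2F)
        1αβ-independent : LinearlyIndependent (1# ∷ proj₁ p ∷ proj₂ p ∷ [])
        1αβ-independent q q≈0 = zeros
          where
          -- q₀ + q₁ α + q₂ β = q₀ γ + (q₀ + q₁) α + (q₀ + q₂) β.
          f : Vector ℝ 3
          f = fromℚ (q 0F) ∷ fromℚ (q 0F) + fromℚ (q 1F) ∷ fromℚ (q 0F) + fromℚ (q 2F) ∷ []
          rat-f : ∀ i → Rational (f i)
          rat-f 0F = q 0F , refl
          rat-f 1F = rat-+ (q 0F , refl) (q 1F , refl)
          rat-f 2F = rat-+ (q 0F , refl) (q 2F , refl)
          f≈0 : ∀ i → f i ≈ 0#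
          f≈0 = coordinates-independent f rat-f (trans (byRole-sum c (λ i → f i * coordinate p i)) (trans
            (solve 5 (λ x y z a b →
              x :* (:1 :- a :- b) :+ (x :+ y) :* a :+ (x :+ z) :* b :=
              x :* :1 :+ (y :* a :+ (z :* b :+ :0))) refl
              (fromℚ (q 0F)) (fromℚ (q 1F)) (fromℚ (q 2F)) (proj₁ p) (proj₂ p)) q≈0))
          cancel : ∀ {x y} → x ≈ 0# → x + y ≈ 0# → y ≈ 0#
          cancel {x} {y} x≈0 x+y≈0 = trans (sym (+-identityˡ y)) (trans (+-congʳ (sym x≈0)) x+y≈0)
          zeros : ∀ i → q i ≡ 0ℚ
          zeros 0F = fromℚ≈0⇒≡0 (q 0F) (f≈0 0F)
          zeros 1F = fromℚ≈0⇒≡0 (q 1F) (cancel (f≈0 0F) (f≈0 1F))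
          zeros 2F = fromℚ≈0⇒≡0 (q 2F) (cancel (f≈0 0F) (f≈0 2F))

      -- Here x, y, z are the coordinates of the scale `t`. The point's coordinates have norms N(t),
      -- N(t)N(θ) and N(t)N(θ(θ - k)), so the unknown N(t) cancels when weights are compared.
      module Norms {x y z} (rx : Rational x) (ry : Rational y) (rz : Rational z) (t≈ : t ≈ ⟪ x , y , z ⟫) where
        rw = rat-+ ry (rat-* rat-M rz)
        rk = rat-fromℕ k

        midᵗ≈ : coordinate p (mid c) ≈ ⟪ z , x , y + M * z ⟫
        midᵗ≈ = trans midᵗ (trans (*-comm t θ) (trans (*-congˡ t≈) (θ*⟪⟫ x y z)))

        bigᵗ≈ : coordinate p (big c) ≈ ⟪ (y + M * z) - fromℕ k * z , z - fromℕ k * x , x + M * (y + M * z) - fromℕ k * (y + M * z) ⟫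
        bigᵗ≈ = trans bigᵗ (trans (solve 3 (λ t θ k → t :* (θ :* (θ :- k)) := (θ :- k) :* (θ :* t)) refl t θ (fromℕ k))
          (trans (*-congˡ (trans (*-congˡ t≈) (θ*⟪⟫ x y z))) ([θ-k]*⟪⟫ (fromℕ k) z x (y + M * z))))

        norm-s = hasNorm rx ry rz (trans smallᵗ (trans (*-identityʳ t) t≈))
        norm-μ = hasNorm rz rx rw midᵗ≈
        norm-b = hasNorm (rat-+ rw (rat-neg (rat-* rk rz))) (rat-+ rz (rat-neg (rat-* rk rx)))
          (rat-+ (rat-+ rx (rat-* rat-M rw)) (rat-neg (rat-* rk rw))) bigᵗ≈

        ν : Vector ℚ 3
        ν = arrange (proj₁ norm-s) (proj₁ norm-μ) (proj₁ norm-b) c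

        ν-isNorm : ∀ i → IsNorm K (coordinate p i) (ν i)
        ν-isNorm = byRole c
          (≡.subst (IsNorm K _) (≡.sym (arrange-small _ _ _ c)) (proj₂ (proj₂ norm-s)))
          (≡.subst (IsNorm K _) (≡.sym (arrange-mid _ _ _ c)) (proj₂ (proj₂ norm-μ)))
          (≡.subst (IsNorm K _) (≡.sym (arrange-big _ _ _ c)) (proj₂ (proj₂ norm-b)))

        -- The scale `t` is invertible, with inverse `1# + θ + bigAt k`.
        norm-s≢0 : proj₁ norm-s ≢ 0ℚ
        norm-s≢0 s≡0 = norm≈0⇒≉invertible rx ry rz
          (trans (sym (proj₁ (proj₂ norm-s))) (trans (reflexive (≡.cong fromℚ s≡0)) fromℚ-0))
          (1# + θ + bigAt k) (trans (*-congʳ (sym t≈)) (t[s+μ+b]≈1 h))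

        norm-μ≡ : proj₁ norm-μ ≡ proj₁ norm-s ℚ.* 1ℚ
        norm-μ≡ = ≡.trans (fromℚ-injective {proj₁ norm-μ} {proj₁ norm-s} (trans (proj₁ (proj₂ norm-μ))
          (trans (norm-θ x y z) (sym (proj₁ (proj₂ norm-s)))))) (≡.sym (ℚ.*-identityʳ (proj₁ norm-s)))

        norm-b≡ : proj₁ norm-b ≡ proj₁ norm-s ℚ.* δ
        norm-b≡ = fromℚ-injective {proj₁ norm-b} {proj₁ norm-s ℚ.* δ} (begin
          fromℚ (proj₁ norm-b)
            ≈⟨ trans (proj₁ (proj₂ norm-b)) (norm-[θ-k] (fromℕ k) z x (y + M * z)) ⟩
          norm z x (y + M * z) * (fromℕ k * fromℕ k * (M - fromℕ k) + 1#)
            ≈⟨ *-cong (norm-θ x y z) fromℕ-n ⟩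
          norm x y z * fromℕ n
            ≈⟨ *-cong (proj₁ (proj₂ norm-s)) δ≈n ⟨
          fromℚ (proj₁ norm-s) * fromℚ δ
            ≈⟨ fromℚ-* (proj₁ norm-s) δ ⟨
          fromℚ (proj₁ norm-s ℚ.* δ) ∎)

        ν≢0 : ∀ i → ν i ≢ 0ℚ
        ν≢0 = byRole c
          (λ eq → norm-s≢0 (≡.trans (≡.sym (arrange-small _ _ _ c)) eq))
          (λ eq → pq≢0 norm-s≢0 1≢0 (≡.trans (≡.sym (≡.trans (arrange-mid _ _ _ c) norm-μ≡)) eq))
          (λ eq → pq≢0 norm-s≢0 δ≢0 (≡.trans (≡.sym (≡.trans (arrange-big _ _ _ c) norm-b≡)) eq))
          where
          1≢0 : 1ℚ ≢ 0ℚ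
          1≢0 ()

        open Weights p ν ν≢0 0<coordinate

        small<mid : weight (small c) < weight (mid c)
        small<mid = weight-<
          (≡.trans (≡.trans (arrange-mid _ _ _ c) norm-μ≡) (≡.cong (ℚ._* 1ℚ) (≡.sym (arrange-small _ _ _ c))))
          (λ ()) fromℚ-1 0<1
          (<-respˡ-≈ (sym (solve 1 (λ x → x :* (:1 :* :1) := x) refl _))
            (^-monoˡ-< 4 (0<coordinate (small c)) s<μ))
          where
          s<μ : coordinate p (small c) < coordinate p (mid c)
          s<μ = <-respˡ-≈ (sym smallᵗ) (<-respʳ-≈ (sym midᵗ) (*-monoʳ-< 0<t 1<θ))

        small<big : weight (small c) < weight (big c)
        small<big = weight-<
          (≡.trans (≡.trans (arrange-big _ _ _ c) norm-b≡) (≡.cong (ℚ._* δ) (≡.sym (arrange-small _ _ _ c))))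
          δ≢0 (trans (∣q∣≈q {δ} (<-respʳ-≈ (sym δ≈n) 0<n)) δ≈n) 0<n
          (<-respˡ-≈ (*-congʳ (Exp.^-congˡ semiring 5 (sym (trans smallᵗ (*-identityʳ t)))))
            (<-respʳ-≈ (trans (sym (CommutativeExp.^-distrib-* commutativeSemiring t (bigAt k) 5))
                         (Exp.^-congˡ semiring 5 (sym bigᵗ)))
              (*-monoʳ-< (0<x^n 5 0<t) n²<big^5)))

        isEpsilon : IsEpsilon K p (direction c)
        isEpsilon = record
          { norm          = ν
          ; isNorm        = ν-isNorm
          ; uniqueMaximum = unique-maximum c small<mid small<big
          ; inTriangle    = △-direction c Δp mid<big
          }

      bigAt-suc : bigAt k - θ ≈ bigAt (suc k)
      bigAt-suc = solve 2 (λ t k → t :* (t :- k) :- t := t :* (t :- (:1 :+ k))) refl θ (fromℕ k)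

      step : ∃[ q ] Step K p q × Homogeneous c q 1# θ (bigAt (suc k))
      step = T (direction c) p p∈△ , record
        { p∈Δ[K]    = inΔ[K]
        ; ε         = direction c
        ; isEpsilon = ε
        ; image     = refl , refl
        } , homogeneous-resp refl refl bigAt-suc (homogeneous-T p∈△ h)
        where
        t∈span = K⇒span t∈K
        open InSpan t∈span using (rat-a; rat-b; rat-c; x≈)
        ε = Norms.isEpsilon rat-a rat-b rat-c x≈
        p∈△ = IsEpsilon.inTriangle ε

  -- A point reached from p in n steps, in the form that composes definitionally.
  Reaches : ℕ → Point → Point → Set
  Reaches n p q = ∀ l r → Iterate K l q r → Iterate K (n ℕ.+ l) p r

  segment : ∀ c d k p → k ℕ.+ d ≡ m → Homogeneous c p 1# θ (bigAt k) →
            ∃[ q ] Homogeneous c q 1# θ (bigAt m) × Reaches d p q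
  segment c zero    k p k+d≡m h =
    p , ≡.subst (λ k → Homogeneous c p 1# θ (bigAt k)) (≡.trans (≡.sym (ℕ.+-identityʳ k)) k+d≡m) h , λ l r it → it
  segment c (suc d) k p k+1+d≡m h = prepend (step k d k+1+d≡m h)
    where
    prepend : ∃[ p′ ] Step K p p′ × Homogeneous c p′ 1# θ (bigAt (suc k)) →
              ∃[ q ] Homogeneous c q 1# θ (bigAt m) × Reaches (suc d) p q
    prepend (p′ , p→p′ , h′) with segment c d (suc k) p′ (≡.trans (≡.sym (ℕ.+-suc k d)) k+1+d≡m) h′
    ... | q , hq , p′→q = q , hq , λ l r it → p′ , p→p′ , p′→q l r it

  -- θ (θ - m) = θ⁻¹, so multiplying (1 , θ , θ (θ - m)) by θ permutes the roles.
  rotate : ∀ c {p} → Homogeneous c p 1# θ (bigAt m) → Homogeneous (next c) p 1# θ (bigAt 0)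
  rotate c {p} h = record
    { t      = t * bigAt m
    ; 0<t    = *-pos 0<t (*-pos 0<θ (x<y⇒0<y-x M<θ))
    ; smallᵗ = trans (reflexive (≡.cong (coordinate p) (small-next c))) (trans bigᵗ (sym (*-identityʳ _)))
    ; midᵗ   = trans (reflexive (≡.cong (coordinate p) (mid-next c))) (trans smallᵗ t≈)
    ; bigᵗ   = trans (reflexive (≡.cong (coordinate p) (big-next c))) (trans midᵗ tθ≈)
    }
    where
    open Homogeneous h
    t≈ : t * 1# ≈ t * bigAt m * θ
    t≈ = trans (*-congˡ (sym isRoot))
      (solve 3 (λ t θ m → t :* (θ :* θ :* (θ :- m)) := t :* (θ :* (θ :- m)) :* θ) refl t θ M)
    tθ≈ : t * θ ≈ t * bigAt m * bigAt 0
    tθ≈ = begin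
      t * θ                    ≈⟨ *-congʳ (*-identityʳ t) ⟨
      t * 1# * θ               ≈⟨ *-congʳ t≈ ⟩
      t * bigAt m * θ * θ      ≈⟨ solve 2 (λ x t → x :* t :* t := x :* (t :* (t :- :0))) refl _ θ ⟩
      t * bigAt m * bigAt 0    ∎

  Start : Point → Set
  Start p = Homogeneous 0F p 1# θ (bigAt 0)

  -- Three segments run through the three phases and `next` leads back to `0F`. The return is
  -- recorded as `Start q`, so another lap can begin at `q` itself.
  cycle : ∀ p → Start p → ∃[ q ] Start q × (∀ l r → Iterate K l q r → Iterate K (m ℕ.+ (m ℕ.+ (m ℕ.+ l))) p r)
  cycle p h₀ with segment 0F m 0 p ≡.refl h₀
  ... | p₁ , h₁ , p→p₁ with segment 1F m 0 p₁ ≡.refl (rotate 0F h₁)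
  ...   | p₂ , h₂ , p₁→p₂ with segment 2F m 0 p₂ ≡.refl (rotate 1F h₂)
  ...     | q , h₃ , p₂→q = q , rotate 2F h₃ , λ l r it →
    p→p₁ _ r (p₁→p₂ _ r (p₂→q l r it))

  0<big₀ : 0# < bigAt 0
  0<big₀ = *-pos 0<θ (<-respʳ-≈ (solve 1 (λ t → t := t :- :0) refl θ) 0<θ)

  start-unique : ∀ {p q} → Start p → Start q → q ≈ₚ p
  start-unique h h′ = homogeneous-unique 0<1 0<θ 0<big₀ h′ h

  periodic : ∀ p → Start p → ∃[ m₁ ] ∃[ n₁ ] m₁ > 0 × n₁ > 0 × m₁ ≢ n₁ ×
             (∃[ q ] Iterate K m₁ p q × Iterate K n₁ p q)
  periodic p h with cycle p h
  ... | p₁ , h₁ , p→p₁ with cycle p₁ h₁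
  ...   | p₂ , h₂ , p₁→p₂ =
    -- One lap against two, 3m against 6m steps, with `p` as the common end point. The second lap
    -- starts at `p₁` as it stands; `≈ₚ` is applied only at the end of an iteration.
    m ℕ.+ (m ℕ.+ (m ℕ.+ 0)) , m ℕ.+ (m ℕ.+ (m ℕ.+ period)) , positive 0 , positive period , distinct ,
    p , p→p₁ 0 p (start-unique h h₁) , p→p₁ period p (p₁→p₂ 0 p (start-unique h h₂))
    where
    period = m ℕ.+ (m ℕ.+ (m ℕ.+ 0))
    positive : ∀ l → m ℕ.+ (m ℕ.+ (m ℕ.+ l)) > 0
    positive l = ℕ.≤-trans m>0 (ℕ.m≤m+n m _)
    distinct : m ℕ.+ (m ℕ.+ (m ℕ.+ 0)) ≢ m ℕ.+ (m ℕ.+ (m ℕ.+ period))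
    distinct eq = ℕ.<⇒≢ (positive 0)
      (ℕ.+-cancelˡ-≡ m _ _ (ℕ.+-cancelˡ-≡ m _ _ (ℕ.+-cancelˡ-≡ m _ _ eq)))

  startPoint : ℝ → Point
  startPoint e = 1# * e , θ * e

  startPoint-start : ∀ {e} → 0# < e → (1# + θ + θ ^ 2) * e ≈ 1# → Start (startPoint e)
  startPoint-start {e} 0<e se≈1 = record
    { t      = e
    ; 0<t    = 0<e
    ; smallᵗ = *-comm 1# e
    ; midᵗ   = *-comm θ e
    -- Writing the 1 in γ = 1 - α - β as (1 + θ + θ²)e leaves γ = θ²e.
    ; bigᵗ   = trans (+-congʳ (+-congʳ (sym se≈1)))
        (solve 2 (λ t e → (:1 :+ t :+ t :* (t :* :1)) :* e :- :1 :* e :- t :* e := e :* (t :* (t :- :0))) refl θ e)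
    }

theorem2p9 : (R : RealNumbers) → let open ContinuedFraction R in
    (m : ℕ) → m > 0 →
    (θ : ℝ) → θ ^ 3 - fromℕ m * θ ^ 2 - 1# ≈ 0# →
    let p : Point
        p = (1# / (1# + θ + θ ^ 2) ∵ 0<1+x+x² θ) , (θ / (1# + θ + θ ^ 2) ∵ 0<1+x+x² θ)
    in Δ[ ℚ⟮ θ ⟯ ] p ×
       (∃[ m₁ ] ∃[ n₁ ] m₁ > 0 × n₁ > 0 × m₁ ≢ n₁ ×
         (∃[ q ] Iterate ℚ⟮ θ ⟯ m₁ p q × Iterate ℚ⟮ θ ⟯ n₁ p q))
-- Membership in Δ_K is the case k = 0 of the orbit, where `0 + suc d` computes to m.
theorem2p9 R (suc d) m>0 θ root = inΔ[K] 0 d ≡.refl h , periodic _ h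
  where
  open ContinuedFraction R
  open CubicField R (suc d) m>0
  open RealLemmas R
  open IntegerCoefficients commutativeRing
  isRoot : IsRoot θ
  isRoot = begin
    θ * θ * (θ - M)
      ≈⟨ solve 2 (λ t m → t :* t :* (t :- m) := (t :* (t :* (t :* :1)) :- m :* (t :* (t :* :1)) :- :1) :+ :1) refl θ M ⟩
    (θ ^ 3 - M * θ ^ 2 - 1#) + 1#
      ≈⟨ trans (+-congʳ root) (+-identityˡ 1#) ⟩
    1# ∎
    where open SetoidReasoning setoid
  open Orbit R (suc d) m>0 θ isRoot
  h = startPoint-start (0<inverse (0<1+x+x² θ)) (proj₂ (inverse (0<1+x+x² θ)))
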